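{- Let $\lambda$ be a wide partition, and list its distinct part sizes in decreasing order. If $\lambda$ has exactly three distinct part sizes and either the second or the third part size occurs in $\lambda$ with multiplicity one, or if $\lambda$ has exactly four distinct part sizes and the second and the fourth part sizes both occur with multiplicity one, then $\lambda$ is Latin.
   Context: For partitions $\alpha,\beta$ of the same integer, $\alpha\ge\beta$ (dominance) means $\sum_{k\le j}\alpha_k\ge\sum_{k\le j}\beta_k$ for all $j$; $\mu'$ is the conjugate of $\mu$. $\mu$ is a subpartition of $\lambda$ if the multiset of parts of $\mu$ is a submultiset of that of $\lambda$. $\lambda$ is wide if $\mu\ge\mu'$ for every subpartition $\mu$ of $\lambda$. A tableau of shape $\lambda$ is the Young diagram of $\lambda$ with a positive integer in each cell. $\lambda$ is Latin if there is a tableau of shape $\lambda$ in which no two cells in the same row or column have equal entries and in which, for every $i$, the integer $i$ occurs exactly $\lambda'_i$ times. -}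

module Defs where

open import Data.Nat using (ℕ; zero; suc; _+_; _≤_; _<_; _≥_; _≟_; _≤?_)
open import Data.List using (List; []; _∷_; length; filter; map; take; upTo; _++_; deduplicate; head)
open import Data.List.Relation.Unary.All using (All)
open import Data.List.Relation.Unary.Linked using (Linked)
open import Data.Maybe using (maybe)
open import Data.Nat.ListAction using (sum)
open import Data.Product using (_×_; _,_; Σ; ∃)
open import Relation.Binary.PropositionalEquality using (_≡_; _≢_)

IsPartition : List ℕ → Set
IsPartition xs = Linked _≥_ xs × All (λ x → 0 < x) xs

mult : ℕ → List ℕ → ℕ
mult x xs = length (filter (x ≟_) xs)

largest : List ℕ → ℕ
largest xs = maybe (λ x → x) 0 (head xs)

conj : List ℕ → List ℕ
conj xs = map (λ i → length (filter (suc i ≤?_) xs)) (upTo (largest xs))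

psum : ℕ → List ℕ → ℕ
psum j xs = sum (take j xs)

Dominates : List ℕ → List ℕ → Set
Dominates α β = ∀ j → psum j β ≤ psum j α

Subpartition : List ℕ → List ℕ → Set
Subpartition μ lam = IsPartition μ × (∀ x → mult x μ ≤ mult x lam)

Wide : List ℕ → Set
Wide lam = ∀ μ → Subpartition μ lam → Dominates μ (conj μ)

rowLen : List ℕ → ℕ → ℕ
rowLen [] r = 0
rowLen (x ∷ xs) zero = x
rowLen (x ∷ xs) (suc r) = rowLen xs r

cellsFrom : ℕ → List ℕ → List (ℕ × ℕ)
cellsFrom r [] = []
cellsFrom r (x ∷ xs) = map (λ c → r , c) (upTo x) ++ cellsFrom (suc r) xs

cells : List ℕ → List (ℕ × ℕ)
cells = cellsFrom 0

occurrences : List ℕ → (ℕ → ℕ → ℕ) → ℕ → ℕ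
occurrences lam T i = length (filter (λ rc → T (Data.Product.proj₁ rc) (Data.Product.proj₂ rc) ≟ i) (cells lam))

-- T (restricted to the cells of lam) is a Latin tableau of shape lam
IsLatinTableau : List ℕ → (ℕ → ℕ → ℕ) → Set
IsLatinTableau lam T =
  (∀ r c → c < rowLen lam r → 0 < T r c)
  × (∀ r c c′ → c < rowLen lam r → c′ < rowLen lam r → c ≢ c′ → T r c ≢ T r c′)
  × (∀ r r′ c → c < rowLen lam r → c < rowLen lam r′ → r ≢ r′ → T r c ≢ T r′ c)
  × (∀ i → occurrences lam T (suc i) ≡ rowLen (conj lam) i)

Latin : List ℕ → Set
Latin lam = Σ (ℕ → ℕ → ℕ) (IsLatinTableau lam)

-- distinct part sizes, in the order they appear (decreasing for a partition)
distinctParts : List ℕ → List ℕ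
distinctParts = deduplicate _≟_

{-# OPTIONS --safe #-}
module Submission where

-- In a Latin tableau of shape λ each row of length l is a permutation of 1, …, l. All partitions in the theorem
-- have the form a^m b c^r d with a ≥ b ≥ c ≥ d, and their columns and symbols fall into four blocks of widths
-- d, c - d, b - c, a - b. It is enough to say how many symbols of each block stand in each block of columns
-- for each group of equal rows: if these counts have the right margins and never exceed the number of
-- (column, symbol) pairs, they can be split equitably into rows, then symbols, then columns. For the rows
-- b, c^r and d the counts are written down explicitly, sending large columns to small symbols as far as possible.
-- The rows a^m then form a transportation problem, solvable iff every cut is large enough. A cut of weight at
-- most m is harmless because λ has at most a rows; as b occurs once, the blocks of width a - b and b - c never
-- matter; the remaining cuts are the dominance inequalities of a^m b c^r d and a^m c^r d at d, c - d and c.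

open import Defs
open import Data.Nat using (ℕ)
open import Data.List using (List; []; _∷_)
open import Data.Product using (_×_; ∃; ∃-syntax)
open import Data.Sum using (_⊎_)
open import Relation.Binary.PropositionalEquality using (_≡_)

open import Data.Nat using (zero; suc; _+_; _*_; _∸_; _⊓_; _≤_; _<_; _≥_; _<ᵇ_; z≤n; s≤s; s≤s⁻¹; _≤?_; _<?_; _≟_; >-nonZero)
open import Data.Nat.Properties hiding (_≤?_; _<?_; _≟_)
open import Data.Nat.ListAction using () renaming (sum to sumˡ)
open import Data.Nat.Tactic.RingSolver using (solve; solve-∀)
open import Data.Bool using (Bool; true; false; if_then_else_; _∧_; _∨_)
open import Data.Fin using (Fin; zero; suc; toℕ; fromℕ<)
open import Data.Fin.Patterns using (0F; 1F; 2F; 3F)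
open import Data.Fin.Subset using (Subset; ⁅_⁆; ⊤; _∩_; _∪_)
open import Data.Fin.Subset.Properties using (anySubset?)
open import Data.List using (length; filter; map; take; upTo; applyUpTo; allFin; replicate; _++_)
open import Data.List.Membership.Propositional using (_∈_)
open import Data.List.Membership.Propositional.Properties using (∈-allFin)
open import Data.List.Relation.Unary.All using (All) renaming ([] to []ᵃ; _∷_ to _∷ᵃ_)
open import Data.List.Relation.Unary.Any using (here; there)
open import Data.List.Relation.Unary.Linked using (Linked; [-]) renaming ([] to []ˡ; _∷_ to _∷ˡ_)
open import Data.Product using (_,_; proj₁; proj₂)
open import Data.Sum using (inj₁; inj₂)
open import Data.Vec using (Vec; lookup; _[_]≔_) renaming ([] to []ᵛ; _∷_ to _∷ᵛ_; sum to sumᵛ)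
open import Data.Vec.Properties using (lookup-zipWith; lookup-replicate; lookup∘updateAt; lookup∘updateAt′)
open import Function using (_∘_; id)
open import Relation.Nullary using (¬_; Dec; yes; no; does; contradiction)
open import Relation.Nullary.Decidable using (¬?; decidable-stable; dec-true; dec-false)
open import Relation.Unary using (Decidable)
open import Relation.Binary.PropositionalEquality using (_≢_; refl; sym; trans; cong; cong₂; subst; subst₂; module ≡-Reasoning)
open import Algebra.Properties.Semiring.Sum +-*-semiring
  using (sum; sum-cong-≗; ∑-distrib-+; ∑-comm; *-distribˡ-sum; *-distribʳ-sum; sum-replicate-zero)
import Data.Fin.Properties as Finₚ
import Data.List.Properties as Listₚ
import Data.List.Relation.Unary.All as All
import Data.List.Relation.Unary.All.Properties as Allₚ

-- Integral transportation

-- The short rows are fixed before the rows a^m, and the difficulty is to choose them so that no cut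
-- of the remaining problem is overloaded. The row b takes the block counts of the order-reversing
-- permutation of 1, ..., b; how b - c compares with d and c - d decides which blocks this
-- permutation pairs, hence the four regimes of `plan`. All counts for short rows are symmetric
-- under exchange of columns and symbols, so column sums follow from row sums. Given this symmetry,
-- the rows c^r have a single degree of freedom, the number of pairs between the blocks of widths d
-- and c - d, and the row d has none. The same family of inequalities serves twice: for a^m b c^r d
-- and a^m c^r d it bounds the cuts, and with m = 0, that is for b c^r d and c^r d, it bounds what
-- the short rows take from a pair of blocks. The cases of the theorem fit one form because
-- neighbouring sizes may coincide: three sizes with the second occurring once is c = d, three sizes
-- with the third occurring once is b = c.

Matrix : ℕ → ℕ → Set
Matrix p q = Fin p → Fin q → ℕ

sum-mono : ∀ {n} {f g : Fin n → ℕ} → (∀ i → f i ≤ g i) → sum f ≤ sum g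
sum-mono {zero}  f≤g = z≤n
sum-mono {suc n} f≤g = +-mono-≤ (f≤g zero) (sum-mono (f≤g ∘ suc))

sum-zero : ∀ {n} {f : Fin n → ℕ} → (∀ i → f i ≡ 0) → sum f ≡ 0
sum-zero {n} f≡0 = trans (sum-cong-≗ f≡0) (sum-replicate-zero n)

term≤sum : ∀ {n} (f : Fin n → ℕ) i → f i ≤ sum f
term≤sum f zero    = m≤m+n _ _
term≤sum f (suc i) = ≤-trans (term≤sum (f ∘ suc) i) (m≤n+m _ _)

squeeze : ∀ {a b c d} → a ≤ b → c ≤ d → b + d ≤ a + c → b ≤ a
squeeze {a} {b} {c} {d} a≤b c≤d h =
  +-cancelʳ-≤ c b a (≤-trans (+-monoʳ-≤ b c≤d) h)

-- With equal totals no term can be strictly smaller. This turns one-sided bounds on column sums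
-- into exact values once the row sums are known.
sum-squeeze : ∀ {n} {f g : Fin n → ℕ} → (∀ i → f i ≤ g i) → sum g ≤ sum f → ∀ i → f i ≡ g i
sum-squeeze f≤g Σg≤Σf zero = ≤-antisym (f≤g zero) (squeeze (f≤g zero) (sum-mono (f≤g ∘ suc)) Σg≤Σf)
sum-squeeze {suc n} {f} {g} f≤g Σg≤Σf (suc i) = sum-squeeze (f≤g ∘ suc)
  (squeeze (sum-mono (f≤g ∘ suc)) (f≤g zero)
    (subst₂ _≤_ (+-comm (g zero) _) (+-comm (f zero) _) Σg≤Σf)) i

⟦_⟧ : Bool → ℕ
⟦ b ⟧ = if b then 1 else 0

δ : ∀ {n} → Fin n → Fin n → ℕ
δ i j = ⟦ does (i Finₚ.≟ j) ⟧

δ-refl : ∀ {n} (i : Fin n) → δ i i ≡ 1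
δ-refl i with i Finₚ.≟ i
... | yes _  = refl
... | no i≢i = contradiction refl i≢i

δ-suc : ∀ {n} (i j : Fin n) → δ (suc i) (suc j) ≡ δ i j
δ-suc i j with i Finₚ.≟ j
... | yes _ = refl
... | no  _ = refl

sum-δ : ∀ {n} (i : Fin n) (f : Fin n → ℕ) → sum (λ j → δ i j * f j) ≡ f i
sum-δ {suc n} zero    f =
  trans (cong₂ _+_ (*-identityˡ (f zero)) (sum-zero {n} {λ j → 0} λ _ → refl)) (+-identityʳ _)
sum-δ {suc n} (suc i) f = trans (sum-cong-≗ λ j → cong (_* f (suc j)) (δ-suc i j)) (sum-δ i (f ∘ suc))

χ : ∀ {n} → Subset n → Fin n → ℕ
χ A i = ⟦ lookup A i ⟧

χ-⊤ : ∀ {n} (i : Fin n) → χ ⊤ i ≡ 1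
χ-⊤ i = cong ⟦_⟧ (lookup-replicate i true)

χ-⁅⁆ : ∀ {n} (i j : Fin n) → χ ⁅ i ⁆ j ≡ δ i j
χ-⁅⁆ zero    zero    = refl
χ-⁅⁆ zero    (suc j) = cong ⟦_⟧ (lookup-replicate j false)
χ-⁅⁆ (suc i) zero    = refl
χ-⁅⁆ (suc i) (suc j) = trans (χ-⁅⁆ i j) (sym (δ-suc i j))

χ-remove : ∀ {n} (A : Subset n) i → lookup A i ≡ true → ∀ j → χ (A [ i ]≔ false) j + δ i j ≡ χ A j
χ-remove A i i∈A j with i Finₚ.≟ j
... | yes refl = trans (cong (λ b → ⟦ b ⟧ + 1) (lookup∘updateAt i A)) (sym (cong ⟦_⟧ i∈A))
... | no  i≢j  = trans (+-identityʳ _) (cong ⟦_⟧ (lookup∘updateAt′ j i (i≢j ∘ sym) A))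

χ-uncross : ∀ {n} (A A′ : Subset n) i → χ (A ∩ A′) i + χ (A ∪ A′) i ≡ χ A i + χ A′ i
χ-uncross A A′ i rewrite lookup-zipWith _∧_ i A A′ | lookup-zipWith _∨_ i A A′ with lookup A i | lookup A′ i
... | false | false = refl
... | false | true  = refl
... | true  | false = refl
... | true  | true  = refl

weight : ∀ {n} → Subset n → (Fin n → ℕ) → ℕ
weight A f = sum λ i → χ A i * f i

weight-⊤ : ∀ {n} (f : Fin n → ℕ) → weight ⊤ f ≡ sum f
weight-⊤ f = sum-cong-≗ λ i → trans (cong (_* f i) (χ-⊤ i)) (*-identityˡ (f i))

weight-⁅⁆ : ∀ {n} i (f : Fin n → ℕ) → weight ⁅ i ⁆ f ≡ f i
weight-⁅⁆ i f = trans (sum-cong-≗ λ j → cong (_* f j) (χ-⁅⁆ i j)) (sum-δ i f)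

weight-+ : ∀ {n} (A : Subset n) f g → weight A (λ i → f i + g i) ≡ weight A f + weight A g
weight-+ A f g = trans (sum-cong-≗ λ i → *-distribˡ-+ (χ A i) (f i) (g i)) (∑-distrib-+ (λ i → χ A i * f i) (λ i → χ A i * g i))

weight-cong : ∀ {n} (A : Subset n) {f g : Fin n → ℕ} → (∀ i → f i ≡ g i) → weight A f ≡ weight A g
weight-cong A f≗g = sum-cong-≗ λ i → cong (χ A i *_) (f≗g i)

weight-remove : ∀ {n} (A : Subset n) i f → lookup A i ≡ true → weight (A [ i ]≔ false) f + f i ≡ weight A f
weight-remove A i f i∈A = begin
  weight (A [ i ]≔ false) f + f i                              ≡⟨ cong (weight (A [ i ]≔ false) f +_) (sum-δ i f) ⟨
  weight (A [ i ]≔ false) f + sum (λ j → δ i j * f j)          ≡⟨ ∑-distrib-+ (λ j → χ (A [ i ]≔ false) j * f j) (λ j → δ i j * f j) ⟨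
  sum (λ j → χ (A [ i ]≔ false) j * f j + δ i j * f j)         ≡⟨ sum-cong-≗ (λ j → *-distribʳ-+ (f j) (χ (A [ i ]≔ false) j) (δ i j)) ⟨
  sum (λ j → (χ (A [ i ]≔ false) j + δ i j) * f j)             ≡⟨ sum-cong-≗ (λ j → cong (_* f j) (χ-remove A i i∈A j)) ⟩
  weight A f                                          ∎
  where open ≡-Reasoning

weight-uncross : ∀ {n} (A A′ : Subset n) f → weight (A ∩ A′) f + weight (A ∪ A′) f ≡ weight A f + weight A′ f
weight-uncross A A′ f = begin
  weight (A ∩ A′) f + weight (A ∪ A′) f                     ≡⟨ ∑-distrib-+ (λ i → χ (A ∩ A′) i * f i) (λ i → χ (A ∪ A′) i * f i) ⟨
  sum (λ i → χ (A ∩ A′) i * f i + χ (A ∪ A′) i * f i)       ≡⟨ sum-cong-≗ pointwise ⟩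
  sum (λ i → χ A i * f i + χ A′ i * f i)                    ≡⟨ ∑-distrib-+ (λ i → χ A i * f i) (λ i → χ A′ i * f i) ⟩
  weight A f + weight A′ f                                  ∎
  where
  open ≡-Reasoning
  pointwise : ∀ i → χ (A ∩ A′) i * f i + χ (A ∪ A′) i * f i ≡ χ A i * f i + χ A′ i * f i
  pointwise i = begin
    χ (A ∩ A′) i * f i + χ (A ∪ A′) i * f i   ≡⟨ *-distribʳ-+ (f i) (χ (A ∩ A′) i) _ ⟨
    (χ (A ∩ A′) i + χ (A ∪ A′) i) * f i       ≡⟨ cong (_* f i) (χ-uncross A A′ i) ⟩
    (χ A i + χ A′ i) * f i                    ≡⟨ *-distribʳ-+ (f i) (χ A i) _ ⟩
    χ A i * f i + χ A′ i * f i                ∎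

rect : ∀ {p q} → Matrix p q → Subset p → Subset q → ℕ
rect c A B = weight A λ i → weight B (c i)

-- Submodularity, with row sets and column sets moving in opposite directions; it holds cell by cell
-- and so reduces to the four membership bits.
rect-uncross : ∀ {p q} (c : Matrix p q) A A′ B B′ →
  rect c (A ∩ A′) (B ∪ B′) + rect c (A ∪ A′) (B ∩ B′) ≤ rect c A B + rect c A′ B′
rect-uncross {q = q} c A A′ B B′ =
  subst₂ _≤_ (∑-distrib-+ (λ i → χ (A ∩ A′) i * weight (B ∪ B′) (c i)) (λ i → χ (A ∪ A′) i * weight (B ∩ B′) (c i)))
             (∑-distrib-+ (λ i → χ A i * weight B (c i)) (λ i → χ A′ i * weight B′ (c i)))
    (sum-mono row)
  where
  cell : ∀ a a′ b b′ v → ⟦ a ∧ a′ ⟧ * (⟦ b ∨ b′ ⟧ * v) + ⟦ a ∨ a′ ⟧ * (⟦ b ∧ b′ ⟧ * v) ≤ ⟦ a ⟧ * (⟦ b ⟧ * v) + ⟦ a′ ⟧ * (⟦ b′ ⟧ * v)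
  cell false false _     _     v = z≤n
  cell false true  false false v = z≤n
  cell false true  false true  v = z≤n
  cell false true  true  false v = z≤n
  cell false true  true  true  v = ≤-refl
  cell true  false false false v = z≤n
  cell true  false false true  v = z≤n
  cell true  false true  false v = z≤n
  cell true  false true  true  v = ≤-reflexive (sym (+-identityʳ _))
  cell true  true  false false v = z≤n
  cell true  true  false true  v = ≤-reflexive (+-identityʳ _)
  cell true  true  true  false v = ≤-refl
  cell true  true  true  true  v = ≤-refl

  pull : ∀ k (D : Subset q) f → k * weight D f ≡ sum λ j → k * (χ D j * f j)
  pull k D f = *-distribˡ-sum k λ j → χ D j * f j

  row : ∀ i → χ (A ∩ A′) i * weight (B ∪ B′) (c i) + χ (A ∪ A′) i * weight (B ∩ B′) (c i)
            ≤ χ A i * weight B (c i) + χ A′ i * weight B′ (c i)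
  row i = begin
    χ (A ∩ A′) i * weight (B ∪ B′) (c i) + χ (A ∪ A′) i * weight (B ∩ B′) (c i)
      ≡⟨ cong₂ _+_ (pull (χ (A ∩ A′) i) (B ∪ B′) (c i)) (pull (χ (A ∪ A′) i) (B ∩ B′) (c i)) ⟩
    sum (λ j → χ (A ∩ A′) i * (χ (B ∪ B′) j * c i j)) + sum (λ j → χ (A ∪ A′) i * (χ (B ∩ B′) j * c i j))
      ≡⟨ ∑-distrib-+ (λ j → χ (A ∩ A′) i * (χ (B ∪ B′) j * c i j)) (λ j → χ (A ∪ A′) i * (χ (B ∩ B′) j * c i j)) ⟨
    sum (λ j → χ (A ∩ A′) i * (χ (B ∪ B′) j * c i j) + χ (A ∪ A′) i * (χ (B ∩ B′) j * c i j))
      ≤⟨ sum-mono cell′ ⟩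
    sum (λ j → χ A i * (χ B j * c i j) + χ A′ i * (χ B′ j * c i j))
      ≡⟨ ∑-distrib-+ (λ j → χ A i * (χ B j * c i j)) (λ j → χ A′ i * (χ B′ j * c i j)) ⟩
    sum (λ j → χ A i * (χ B j * c i j)) + sum (λ j → χ A′ i * (χ B′ j * c i j))
      ≡⟨ cong₂ _+_ (pull (χ A i) B (c i)) (pull (χ A′ i) B′ (c i)) ⟨
    χ A i * weight B (c i) + χ A′ i * weight B′ (c i) ∎
    where
    open ≤-Reasoning
    cell′ : ∀ j → χ (A ∩ A′) i * (χ (B ∪ B′) j * c i j) + χ (A ∪ A′) i * (χ (B ∩ B′) j * c i j)
                ≤ χ A i * (χ B j * c i j) + χ A′ i * (χ B′ j * c i j)
    cell′ j rewrite lookup-zipWith _∧_ i A A′ | lookup-zipWith _∨_ i A A′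
                  | lookup-zipWith _∧_ j B B′ | lookup-zipWith _∨_ j B B′ =
      cell (lookup A i) (lookup A′ i) (lookup B j) (lookup B′ j) (c i j)

module Transport {p q : ℕ} (s : Fin p → ℕ) (d : Fin q → ℕ) (balanced : sum s ≡ sum d) where

  -- The rows in `A` can send at most `rect c A B` into `B` and at most the demand of the complement
  -- of `B` elsewhere. Adding `weight B d` to both sides avoids the complement.
  CutCondition : Matrix p q → Set
  CutCondition c = ∀ A B → weight A s + weight B d ≤ rect c A B + sum d

  Tight : Matrix p q → Subset p → Subset q → Set
  Tight c A B = rect c A B + sum d ≤ weight A s + weight B d

  Violated : Matrix p q → Set
  Violated c = ∃ λ A → ∃ λ B → ¬ (weight A s + weight B d ≤ rect c A B + sum d)

  cut? : ∀ c → CutCondition c ⊎ Violated c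
  cut? c with anySubset? (λ A → anySubset? (λ B → ¬? (weight A s + weight B d ≤? rect c A B + sum d)))
  ... | yes v = inj₂ v
  ... | no ¬v = inj₁ λ A B → decidable-stable (_ ≤? _) λ ¬h → ¬v (A , B , ¬h)

  -- Both uncrossed cuts satisfy the cut condition, while their slacks together are at most the
  -- slacks of the two given cuts, which are zero.
  tight-meet : ∀ {c} → CutCondition c → ∀ {A A′ B B′} → Tight c A B → Tight c A′ B′ → Tight c (A ∩ A′) (B ∪ B′)
  tight-meet {c} cut {A} {A′} {B} {B′} t t′ = squeeze (cut (A ∩ A′) (B ∪ B′)) (cut (A ∪ A′) (B ∩ B′)) (begin
    (r₁ + D) + (r₂ + D)                     ≡⟨ regroup r₁ r₂ D ⟩
    (r₁ + r₂) + (D + D)                     ≤⟨ +-monoˡ-≤ (D + D) (rect-uncross c A A′ B B′) ⟩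
    (rect c A B + rect c A′ B′) + (D + D)   ≡⟨ regroup (rect c A B) _ D ⟨
    (rect c A B + D) + (rect c A′ B′ + D)   ≤⟨ +-mono-≤ t t′ ⟩
    (sA + dB) + (sA′ + dB′)                 ≡⟨ swap sA dB sA′ dB′ ⟩
    (sA + sA′) + (dB + dB′)                 ≡⟨ cong₂ _+_ (weight-uncross A A′ s) (trans (+-comm (weight (B ∪ B′) d) _) (weight-uncross B B′ d)) ⟨
    (weight (A ∩ A′) s + weight (A ∪ A′) s) + (weight (B ∪ B′) d + weight (B ∩ B′) d)
                                            ≡⟨ swap (weight (A ∩ A′) s) (weight (B ∪ B′) d) _ _ ⟨
    (weight (A ∩ A′) s + weight (B ∪ B′) d) + (weight (A ∪ A′) s + weight (B ∩ B′) d) ∎)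
    where
    open ≤-Reasoning
    D = sum d
    r₁ = rect c (A ∩ A′) (B ∪ B′)
    r₂ = rect c (A ∪ A′) (B ∩ B′)
    sA = weight A s
    sA′ = weight A′ s
    dB = weight B d
    dB′ = weight B′ d
    regroup : ∀ a b D → (a + D) + (b + D) ≡ (a + b) + (D + D)
    regroup = solve-∀
    swap : ∀ a b c d → (a + b) + (c + d) ≡ (a + c) + (b + d)
    swap = solve-∀

  decrease : Matrix p q → Fin p → Fin q → Matrix p q
  decrease c i j i′ j′ = c i′ j′ ∸ δ i i′ * δ j j′

  decrease-≤ : ∀ c i j i′ j′ → decrease c i j i′ j′ ≤ c i′ j′
  decrease-≤ c i j i′ j′ = m∸n≤m _ (δ i i′ * δ j j′)

  decrease-+ : ∀ c i j → 0 < c i j → ∀ i′ j′ → decrease c i j i′ j′ + δ i i′ * δ j j′ ≡ c i′ j′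
  decrease-+ c i j pos i′ j′ = m∸n+n≡m (bound i′ j′)
    where
    bound : ∀ i′ j′ → δ i i′ * δ j j′ ≤ c i′ j′
    bound i′ j′ with i Finₚ.≟ i′ | j Finₚ.≟ j′
    ... | yes refl | yes refl = pos
    ... | yes _    | no _     = z≤n
    ... | no _     | _        = z≤n

  rect-decrease : ∀ c i j → 0 < c i j → ∀ A B → rect (decrease c i j) A B + χ A i * χ B j ≡ rect c A B
  rect-decrease c i j pos A B = begin
    rect c′ A B + χ A i * χ B j
      ≡⟨ cong (rect c′ A B +_) (sum-δ i λ i′ → χ A i′ * χ B j) ⟨
    rect c′ A B + sum (λ i′ → δ i i′ * (χ A i′ * χ B j))
      ≡⟨ ∑-distrib-+ (λ i′ → χ A i′ * weight B (c′ i′)) (λ i′ → δ i i′ * (χ A i′ * χ B j)) ⟨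
    sum (λ i′ → χ A i′ * weight B (c′ i′) + δ i i′ * (χ A i′ * χ B j))
      ≡⟨ sum-cong-≗ (λ i′ → trans (rearrange (χ A i′) (weight B (c′ i′)) (δ i i′) (χ B j)) (cong (χ A i′ *_) (row i′))) ⟩
    rect c A B ∎
    where
    open ≡-Reasoning
    c′ = decrease c i j
    rearrange : ∀ a b e f → a * b + e * (a * f) ≡ a * (b + e * f)
    rearrange = solve-∀
    rearrange′ : ∀ e f x → e * (f * x) ≡ x * (e * f)
    rearrange′ = solve-∀
    row : ∀ i′ → weight B (c′ i′) + δ i i′ * χ B j ≡ weight B (c i′)
    row i′ = begin
      weight B (c′ i′) + δ i i′ * χ B j
        ≡⟨ cong (λ v → weight B (c′ i′) + δ i i′ * v) (sum-δ j (χ B)) ⟨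
      weight B (c′ i′) + δ i i′ * sum (λ j′ → δ j j′ * χ B j′)
        ≡⟨ cong (weight B (c′ i′) +_) (trans (*-distribˡ-sum (δ i i′) λ j′ → δ j j′ * χ B j′)
             (sum-cong-≗ λ j′ → rearrange′ (δ i i′) (δ j j′) (χ B j′))) ⟩
      weight B (c′ i′) + weight B (λ j′ → δ i i′ * δ j j′)
        ≡⟨ weight-+ B (c′ i′) _ ⟨
      weight B (λ j′ → c′ i′ j′ + δ i i′ * δ j j′)
        ≡⟨ weight-cong B (decrease-+ c i j pos i′) ⟩
      weight B (c i′) ∎

  total : Matrix p q → ℕ
  total c = rect c ⊤ ⊤

  total-decrease : ∀ c i j → 0 < c i j → suc (total (decrease c i j)) ≡ total c
  total-decrease c i j pos = begin
    suc (total (decrease c i j))                    ≡⟨ +-comm (total (decrease c i j)) 1 ⟨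
    total (decrease c i j) + 1                      ≡⟨ cong (total (decrease c i j) +_) (cong₂ _*_ (χ-⊤ i) (χ-⊤ j)) ⟨
    total (decrease c i j) + χ ⊤ i * χ ⊤ j          ≡⟨ rect-decrease c i j pos ⊤ ⊤ ⟩
    total c                                         ∎
    where open ≡-Reasoning

  TightAt : Matrix p q → Fin p → Fin q → Set
  TightAt c i j = ∃ λ A → ∃ λ B → Tight c A B × lookup A i ≡ true × lookup B j ≡ true

  -- Lowering one cell by a unit costs a rectangle at most one, and only if it contains the cell. A
  -- cut that becomes violated therefore contained the cell and had no slack.
  violated⇒tight : ∀ {c} → CutCondition c → ∀ i j → 0 < c i j → Violated (decrease c i j) → TightAt c i j
  violated⇒tight {c} cut i j pos (A , B , ¬ok) with lookup A i in eqA | lookup B j in eqB | rect-decrease c i j pos A B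
  ... | true  | true  | eq = A , B ,
    ≤-trans (≤-reflexive (trans (cong (_+ sum d) (sym eq)) (cong (_+ sum d) (+-comm (rect (decrease c i j) A B) 1)))) (≰⇒> ¬ok) , eqA , eqB
  ... | true  | false | eq = contradiction (subst (λ v → weight A s + weight B d ≤ v + sum d) (trans (sym eq) (+-identityʳ _)) (cut A B)) ¬ok
  ... | false | _     | eq = contradiction (subst (λ v → weight A s + weight B d ≤ v + sum d) (trans (sym eq) (+-identityʳ _)) (cut A B)) ¬ok

  -- Uncrossing the tight cuts of the positive cells of a row yields a single tight cut through all of them.
  row-tight : ∀ {c} → CutCondition c → ∀ i → (∀ j → 0 < c i j → TightAt c i j) → ∀ {j₀} → 0 < c i j₀ → (js : List (Fin q)) →
    ∃ λ A → ∃ λ B → Tight c A B × lookup A i ≡ true × (∀ j → j ∈ js → 0 < c i j → lookup B j ≡ true)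
  -- The cell `j₀` supplies a tight cut through row `i` before any cell of the list has been
  -- treated.
  row-tight cut i tight {j₀} pos₀ [] with tight j₀ pos₀
  ... | A , B , t , i∈A , _ = A , B , t , i∈A , λ _ ()
  row-tight {c} cut i tight pos₀ (j ∷ js) with row-tight cut i tight pos₀ js | 0 <? c i j
  ... | A , B , t , i∈A , js⊆B | no ¬pos = A , B , t , i∈A , λ where
    j′ (here refl)  pos → contradiction pos ¬pos
    j′ (there j′∈) pos → js⊆B j′ j′∈ pos
  ... | A , B , t , i∈A , js⊆B | yes pos with tight j pos
  ... | A′ , B′ , t′ , i∈A′ , j∈B′ = A ∩ A′ , B ∪ B′ , tight-meet cut {A} {A′} {B} {B′} t t′ ,
    trans (lookup-zipWith _∧_ i A A′) (cong₂ _∧_ i∈A i∈A′) , λ where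
      j′ (here refl) _   → trans (lookup-zipWith _∨_ j B B′) (trans (cong (lookup B j ∨_) j∈B′) (∨-true (lookup B j)))
      j′ (there j′∈) pos → trans (lookup-zipWith _∨_ j′ B B′) (cong (_∨ lookup B′ j′) (js⊆B j′ j′∈ pos))
    where
    ∨-true : ∀ b → b ∨ true ≡ true
    ∨-true false = refl
    ∨-true true  = refl

  -- Take one tight cut with `i` in `A` and all positive cells of row `i` in `B`. Removing `i` from
  -- `A` lowers the supply by `s i` and the capacity by the whole row sum, so the cut condition for
  -- the smaller cut bounds the row sum by `s i`.
  tight-row-≤ : ∀ {c} → CutCondition c → ∀ i → (∀ j → 0 < c i j → TightAt c i j) → sum (c i) ≤ s i
  tight-row-≤ {c} cut i tight with Finₚ.any? (λ j → 0 <? c i j)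
  ... | no ¬pos = ≤-trans (≤-reflexive (sum-zero λ j → n≤0⇒n≡0 (≮⇒≥ λ pos → ¬pos (j , pos)))) z≤n
  ... | yes (j₀ , pos₀) with row-tight cut i tight pos₀ (allFin q)
  ... | A , B , t , i∈A , pos⊆B = +-cancelˡ-≤ (weight (A [ i ]≔ false) s + weight B d) _ _ (begin
    (weight (A [ i ]≔ false) s + weight B d) + sum (c i)       ≤⟨ +-monoˡ-≤ (sum (c i)) (cut (A [ i ]≔ false) B) ⟩
    (rect c (A [ i ]≔ false) B + sum d) + sum (c i)            ≡⟨ swapʳ (rect c (A [ i ]≔ false) B) (sum d) (sum (c i)) ⟩
    (rect c (A [ i ]≔ false) B + sum (c i)) + sum d            ≡⟨ cong (λ v → rect c (A [ i ]≔ false) B + v + sum d) (sum-cong-≗ in-B) ⟨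
    (rect c (A [ i ]≔ false) B + weight B (c i)) + sum d       ≡⟨ cong (_+ sum d) (weight-remove A i (λ i′ → weight B (c i′)) i∈A) ⟩
    rect c A B + sum d                                ≤⟨ t ⟩
    weight A s + weight B d                           ≡⟨ cong (_+ weight B d) (weight-remove A i s i∈A) ⟨
    (weight (A [ i ]≔ false) s + s i) + weight B d             ≡⟨ swapʳ (weight (A [ i ]≔ false) s) (s i) (weight B d) ⟩
    (weight (A [ i ]≔ false) s + weight B d) + s i             ∎)
    where
    open ≤-Reasoning
    swapʳ : ∀ a b c → (a + b) + c ≡ (a + c) + b
    swapʳ = solve-∀
    in-B : ∀ j → χ B j * c i j ≡ c i j
    in-B j with 0 <? c i j
    ... | yes pos = trans (cong (λ b → ⟦ b ⟧ * c i j) (pos⊆B j (∈-allFin j) pos)) (*-identityˡ (c i j))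
    ... | no ¬pos rewrite n≤0⇒n≡0 (≮⇒≥ ¬pos) = *-zeroʳ (χ B j)

  Flow : Matrix p q → Set
  Flow c = ∃ λ (y : Matrix p q) → (∀ i j → y i j ≤ c i j) × (∀ i → sum (y i) ≡ s i) × (∀ j → sum (λ i → y i j) ≡ d j)

  row-≥ : ∀ {c} → CutCondition c → ∀ i → s i ≤ sum (c i)
  row-≥ {c} cut i = +-cancelʳ-≤ (sum d) _ _ (begin
    s i + sum d                        ≡⟨ cong₂ _+_ (weight-⁅⁆ i s) (weight-⊤ d) ⟨
    weight ⁅ i ⁆ s + weight ⊤ d        ≤⟨ cut ⁅ i ⁆ ⊤ ⟩
    rect c ⁅ i ⁆ ⊤ + sum d             ≡⟨ cong (_+ sum d) (trans (weight-⁅⁆ i λ i′ → weight ⊤ (c i′)) (weight-⊤ (c i))) ⟩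
    sum (c i) + sum d                  ∎)
    where open ≤-Reasoning

  column-≥ : ∀ {c} → CutCondition c → ∀ j → d j ≤ sum (λ i → c i j)
  column-≥ {c} cut j = +-cancelˡ-≤ (sum d) _ _ (begin
    sum d + d j                        ≡⟨ cong₂ _+_ (trans (weight-⊤ s) balanced) (weight-⁅⁆ j d) ⟨
    weight ⊤ s + weight ⁅ j ⁆ d        ≤⟨ cut ⊤ ⁅ j ⁆ ⟩
    rect c ⊤ ⁅ j ⁆ + sum d             ≡⟨ cong (_+ sum d) (trans (weight-⊤ λ i → weight ⁅ j ⁆ (c i)) (sum-cong-≗ λ i → weight-⁅⁆ j (c i))) ⟩
    sum (λ i → c i j) + sum d          ≡⟨ +-comm _ (sum d) ⟩
    sum d + sum (λ i → c i j)          ∎)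
    where open ≤-Reasoning

  saturated : ∀ {c} → CutCondition c → (∀ i → sum (c i) ≤ s i) → Flow c
  saturated {c} cut rows≤ = c , (λ _ _ → ≤-refl) , rows , λ j →
    sym (sum-squeeze (column-≥ cut) (≤-reflexive (trans (∑-comm (λ j i → c i j)) (trans (sum-cong-≗ rows) balanced))) j)
    where
    rows : ∀ i → sum (c i) ≡ s i
    rows i = ≤-antisym (rows≤ i) (row-≥ cut i)

  -- The capacities themselves are lowered, a unit at a time, until no row exceeds its supply; a
  -- flow below the lowered matrix is a flow below `c`. If some row is too large, `tight-row-≤`
  -- shows that one of its positive cells can still be lowered. The recursion runs on the total
  -- capacity.
  search : ∀ n {c} → total c ≡ n → CutCondition c → Flow c
  step : ∀ n {c} → total c ≡ n → CutCondition c → ∀ i → s i < sum (c i) → Flow c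
  try : ∀ n {c} → total c ≡ n → CutCondition c → ∀ i j →
        (0 < c i j → TightAt c i j) ⊎ Flow c

  search n {c} eq cut with Finₚ.any? (λ i → s i <? sum (c i))
  ... | no none        = saturated cut λ i → ≮⇒≥ λ h → none (i , h)
  ... | yes (i , over) = step n eq cut i over

  step n {c} eq cut i over with sequence q (λ j → try n eq cut i j)
    where
    sequence : ∀ k {P : Fin k → Set} {Q : Set} → (∀ j → P j ⊎ Q) → (∀ j → P j) ⊎ Q
    sequence zero    f = inj₁ λ ()
    sequence (suc k) f with f zero | sequence k (f ∘ suc)
    ... | inj₂ y | _      = inj₂ y
    ... | inj₁ _ | inj₂ y = inj₂ y
    ... | inj₁ x | inj₁ g = inj₁ λ { zero → x ; (suc j) → g j }
  ... | inj₂ flow  = flow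
  ... | inj₁ tight = contradiction (tight-row-≤ cut i tight) (<⇒≱ over)

  try n {c} eq cut i j with 0 <? c i j
  ... | no ¬pos = inj₁ λ pos → contradiction pos ¬pos
  ... | yes pos with cut? (decrease c i j)
  ... | inj₂ v = inj₁ λ _ → violated⇒tight cut i j pos v
  try zero    {c} eq cut i j | yes pos | inj₁ cut′ with trans (total-decrease c i j pos) eq
  ... | ()
  try (suc n) {c} eq cut i j | yes pos | inj₁ cut′ with search n (suc-injective (trans (total-decrease c i j pos) eq)) cut′
  ... | y , y≤ , rows , columns = inj₂ (y , (λ i′ j′ → ≤-trans (y≤ i′ j′) (decrease-≤ c i j i′ j′)) , rows , columns)

  abstract
    transport : ∀ c → CutCondition c → Flow c
    transport c = search (total c) refl

-- Equitable splitting of matrices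

sum-∸ : ∀ {n} {f g : Fin n → ℕ} → (∀ i → g i ≤ f i) → sum (λ i → f i ∸ g i) + sum g ≡ sum f
sum-∸ {f = f} {g} g≤f = trans (sym (∑-distrib-+ (λ i → f i ∸ g i) g)) (sum-cong-≗ λ i → m∸n+n≡m (g≤f i))

-- X / (1 + w) is a fractional flow with row sums s and column sums d.
uniform-cut : ∀ {p q} (X : Matrix p q) w (s : Fin p → ℕ) (d : Fin q → ℕ) →
  (∀ i → sum (X i) ≡ s i * suc w) → (∀ j → sum (λ i → X i j) ≡ d j * suc w) →
  ∀ A B → weight A s + weight B d ≤ rect X A B + sum d
uniform-cut X w s d rows columns A B = *-cancelʳ-≤ _ _ (suc w) (begin
  (weight A s + weight B d) * suc w
    ≡⟨ *-distribʳ-+ (suc w) (weight A s) _ ⟩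
  weight A s * suc w + weight B d * suc w
    ≡⟨ cong₂ _+_ (scale A s) (scale B d) ⟩
  sum (λ i → χ A i * (s i * suc w)) + sum (λ j → χ B j * (d j * suc w))
    ≡⟨ cong₂ _+_ (weight-cong A rows) (weight-cong B columns) ⟨
  sum (λ i → χ A i * sum (X i)) + sum (λ j → χ B j * sum (λ i → X i j))
    ≡⟨ cong₂ _+_ (sum-cong-≗ λ i → *-distribˡ-sum (χ A i) (X i)) (trans (sum-cong-≗ λ j → *-distribˡ-sum (χ B j) λ i → X i j) (∑-comm λ j i → χ B j * X i j)) ⟩
  sum (λ i → sum (λ j → χ A i * X i j)) + sum (λ i → sum (λ j → χ B j * X i j))
    ≡⟨ join (λ i j → χ A i * X i j) (λ i j → χ B j * X i j) ⟩
  sum (λ i → sum (λ j → χ A i * X i j + χ B j * X i j))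
    ≤⟨ sum-mono (λ i → sum-mono λ j → cell (lookup A i) (lookup B j) (X i j)) ⟩
  sum (λ i → sum (λ j → χ A i * (χ B j * X i j) + X i j))
    ≡⟨ join (λ i j → χ A i * (χ B j * X i j)) X ⟨
  sum (λ i → sum (λ j → χ A i * (χ B j * X i j))) + sum (λ i → sum (X i))
    ≡⟨ cong₂ _+_ (sum-cong-≗ λ i → *-distribˡ-sum (χ A i) λ j → χ B j * X i j) (trans (sum-cong-≗ columns′) (∑-comm λ j i → X i j)) ⟨
  rect X A B + sum (λ j → d j * suc w)
    ≤⟨ +-mono-≤ (m≤m*n (rect X A B) (suc w)) (≤-reflexive (sym (*-distribʳ-sum (suc w) d))) ⟩
  rect X A B * suc w + sum d * suc w
    ≡⟨ *-distribʳ-+ (suc w) (rect X A B) _ ⟨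
  (rect X A B + sum d) * suc w ∎)
  where
  open ≤-Reasoning
  columns′ : ∀ j → d j * suc w ≡ sum (λ i → X i j)
  columns′ j = sym (columns j)
  scale : ∀ {n} (D : Subset n) f → weight D f * suc w ≡ sum λ i → χ D i * (f i * suc w)
  scale D f = trans (*-distribʳ-sum (suc w) λ i → χ D i * f i) (sum-cong-≗ λ i → *-assoc (χ D i) (f i) (suc w))
  join : ∀ {p q} (Y Z : Matrix p q) → sum (λ i → sum (Y i)) + sum (λ i → sum (Z i)) ≡ sum (λ i → sum (λ j → Y i j + Z i j))
  join Y Z = trans (sym (∑-distrib-+ (λ i → sum (Y i)) (λ i → sum (Z i)))) (sum-cong-≗ λ i → sym (∑-distrib-+ (Y i) (Z i)))
  -- For bits, a + b ≤ a b + 1.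
  cell : ∀ a b v → ⟦ a ⟧ * v + ⟦ b ⟧ * v ≤ ⟦ a ⟧ * (⟦ b ⟧ * v) + v
  cell false false v = z≤n
  cell false true  v = ≤-reflexive (+-identityʳ v)
  cell true  false v = ≤-reflexive (trans (+-identityʳ _) (+-identityʳ v))
  cell true  true  v = ≤-reflexive (cong₂ _+_ (sym (+-identityʳ (v + 0))) (+-identityʳ v))

module Peel {p q} (X : Matrix p q) (w : ℕ) (R : Fin p → ℕ) (C : Fin q → ℕ)
  (rows : ∀ i → sum (X i) ≡ R i * suc w) (columns : ∀ j → sum (λ i → X i j) ≤ C j * suc w) where

  -- A dummy row makes all column sums equal to C j * suc w.
  pad : Fin q → ℕ
  pad j = C j * suc w ∸ sum (λ i → X i j)

  X⁺ : Matrix (suc p) q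
  X⁺ zero    = pad
  X⁺ (suc i) = X i

  s : Fin (suc p) → ℕ
  s zero    = sum C ∸ sum R
  s (suc i) = R i

  total : sum (λ j → sum (λ i → X i j)) ≡ sum R * suc w
  total = trans (∑-comm λ j i → X i j) (trans (sum-cong-≗ rows) (sym (*-distribʳ-sum (suc w) R)))

  R≤C : sum R ≤ sum C
  R≤C = *-cancelʳ-≤ _ _ (suc w) (≤-trans (≤-reflexive (sym total))
    (≤-trans (sum-mono columns) (≤-reflexive (sym (*-distribʳ-sum (suc w) C)))))

  balanced : sum s ≡ sum C
  balanced = m∸n+n≡m R≤C

  rows⁺ : ∀ i → sum (X⁺ i) ≡ s i * suc w
  rows⁺ (suc i) = rows i
  rows⁺ zero    = +-cancelʳ-≡ (sum R * suc w) _ _ (begin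
    sum pad + sum R * suc w                             ≡⟨ cong (sum pad +_) total ⟨
    sum pad + sum (λ j → sum (λ i → X i j))             ≡⟨ sum-∸ columns ⟩
    sum (λ j → C j * suc w)                             ≡⟨ *-distribʳ-sum (suc w) C ⟨
    sum C * suc w                                       ≡⟨ cong (_* suc w) balanced ⟨
    (sum C ∸ sum R + sum R) * suc w                     ≡⟨ *-distribʳ-+ (suc w) (sum C ∸ sum R) _ ⟩
    (sum C ∸ sum R) * suc w + sum R * suc w             ∎)
    where open ≡-Reasoning

  columns⁺ : ∀ j → sum (λ i → X⁺ i j) ≡ C j * suc w
  columns⁺ j = m∸n+n≡m (columns j)

  -- An integral substitute for the fraction 1 / (1 + w) of `X`. Columns including the dummy row are
  -- met exactly and the dummy row gives up at most `pad j`, so what remains of a column is at most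
  -- `C j * w`: the remainder satisfies the same hypotheses with one slice fewer.
  peel : ∃ λ (Y : Matrix p q) → (∀ i j → Y i j ≤ X i j) × (∀ i → sum (Y i) ≡ R i)
    × (∀ j → sum (λ i → Y i j) ≤ C j) × (∀ j → sum (λ i → X i j ∸ Y i j) ≤ C j * w)
  peel with Transport.transport s C balanced X⁺ (uniform-cut X⁺ w s C rows⁺ columns⁺)
  ... | Y⁺ , Y⁺≤X⁺ , rowsY , columnsY = Y , Y≤X , rowsY ∘ suc ,
    (λ j → ≤-trans (m≤n+m _ (Y⁺ zero j)) (≤-reflexive (columnsY j))) ,
    λ j → +-cancelˡ-≤ (C j) _ _ (begin
      C j + rest j                                     ≡⟨ cong (_+ rest j) (columnsY j) ⟨
      Y⁺ zero j + sum (λ i → Y i j) + rest j           ≤⟨ +-monoˡ-≤ (rest j) (+-monoˡ-≤ _ (Y⁺≤X⁺ zero j)) ⟩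
      pad j + sum (λ i → Y i j) + rest j               ≡⟨ regroup (pad j) _ (rest j) ⟩
      pad j + (rest j + sum (λ i → Y i j))             ≡⟨ cong (pad j +_) (sum-∸ λ i → Y≤X i j) ⟩
      pad j + sum (λ i → X i j)                        ≡⟨ columns⁺ j ⟩
      C j * suc w                                      ≡⟨ *-suc (C j) w ⟩
      C j + C j * w                                    ∎)
    where
    open ≤-Reasoning
    Y : Matrix p q
    Y i j = Y⁺ (suc i) j
    Y≤X : ∀ i j → Y i j ≤ X i j
    Y≤X i j = Y⁺≤X⁺ (suc i) j
    rest : Fin q → ℕ
    rest j = sum λ i → X i j ∸ Y i j
    regroup : ∀ a b c → a + b + c ≡ a + (c + b)
    regroup = solve-∀

count : ∀ {N n} → (Fin N → Fin n) → Fin n → ℕ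
count f b = sum λ s → δ b (f s)

module Step {p q N n} (f : Fin (suc N) → Fin n) (X : Fin n → Matrix p q) (R : Fin n → Fin p → ℕ) (C : Fin n → Fin q → ℕ)
  (rows : ∀ b i → sum (X b i) ≡ R b i * count f b) (columns : ∀ b j → sum (λ i → X b i j) ≤ C b j * count f b)
  (Y₀ : Matrix p q) (Y₀≤X : ∀ i j → Y₀ i j ≤ X (f zero) i j) (rowsY₀ : ∀ i → sum (Y₀ i) ≡ R (f zero) i)
  (columns-rest : ∀ j → sum (λ i → X (f zero) i j ∸ Y₀ i j) ≤ C (f zero) j * count (f ∘ suc) (f zero)) where

  f′ : Fin N → Fin n
  f′ = f ∘ suc

  b₀ : Fin n
  b₀ = f zero

  X′ : Fin n → Matrix p q
  X′ b i j = X b i j ∸ δ b b₀ * Y₀ i j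

  δY₀≤X : ∀ b i j → δ b b₀ * Y₀ i j ≤ X b i j
  δY₀≤X b i j with b Finₚ.≟ b₀
  ... | yes refl = ≤-trans (≤-reflexive (*-identityˡ _)) (Y₀≤X i j)
  ... | no  _    = z≤n

  rows′ : ∀ b i → sum (X′ b i) ≡ R b i * count f′ b
  rows′ b i = +-cancelʳ-≡ (δ b b₀ * R b i) _ _ (begin
    sum (X′ b i) + δ b b₀ * R b i                     ≡⟨ cong (sum (X′ b i) +_) δR ⟩
    sum (X′ b i) + sum (λ j → δ b b₀ * Y₀ i j)        ≡⟨ sum-∸ (δY₀≤X b i) ⟩
    sum (X b i)                                       ≡⟨ rows b i ⟩
    R b i * (δ b b₀ + count f′ b)                     ≡⟨ expand (R b i) (δ b b₀) _ ⟩
    R b i * count f′ b + δ b b₀ * R b i               ∎)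
    where
    open ≡-Reasoning
    expand : ∀ r d c → r * (d + c) ≡ r * c + d * r
    expand = solve-∀
    δR : δ b b₀ * R b i ≡ sum (λ j → δ b b₀ * Y₀ i j)
    δR with b Finₚ.≟ b₀
    ... | yes refl = trans (cong (1 *_) (sym (rowsY₀ i))) (*-distribˡ-sum 1 (Y₀ i))
    ... | no  _    = sym (sum-zero {q} {λ _ → 0} λ _ → refl)

  columns′ : ∀ b j → sum (λ i → X′ b i j) ≤ C b j * count f′ b
  columns′ b j = helper (b Finₚ.≟ b₀) refl
    where
    helper : (b≟b₀ : Dec (b ≡ b₀)) → (b Finₚ.≟ b₀) ≡ b≟b₀ → sum (λ i → X′ b i j) ≤ C b j * count f′ b
    helper (yes refl) eq = ≤-trans
      (≤-reflexive (sum-cong-≗ λ i → cong (X b i j ∸_) (trans (cong (_* Y₀ i j) (δ-refl b)) (*-identityˡ (Y₀ i j)))))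
      (columns-rest j)
    helper (no _) eq = subst₂ _≤_
      (sum-cong-≗ λ i → cong (λ e → X b i j ∸ e * Y₀ i j) (sym δ≡0))
      (cong (λ e → C b j * (e + count f′ b)) δ≡0)
      (columns b j)
      where
      δ≡0 : δ b b₀ ≡ 0
      δ≡0 = cong (λ e → ⟦ does e ⟧) eq

-- The slices are peeled off one by one, each taking an equal integral share of what is left of its
-- block. Rows are divided exactly and columns only up to a bound, matching a Latin tableau, where a
-- row must contain prescribed symbols and a column must merely avoid repetition.
split : ∀ {p q n} N (f : Fin N → Fin n) (X : Fin n → Matrix p q) (R : Fin n → Fin p → ℕ) (C : Fin n → Fin q → ℕ) →
  (∀ b i → sum (X b i) ≡ R b i * count f b) → (∀ b j → sum (λ i → X b i j) ≤ C b j * count f b) →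
  ∃ λ (Y : Fin N → Matrix p q) → (∀ b i j → sum (λ s → δ b (f s) * Y s i j) ≡ X b i j)
    × (∀ s i → sum (Y s i) ≡ R (f s) i) × (∀ s j → sum (λ i → Y s i j) ≤ C (f s) j)
split zero f X R C rows columns =
  (λ ()) ,
  (λ b i j → sym (n≤0⇒n≡0 (≤-trans (term≤sum (X b i) j) (≤-reflexive (trans (rows b i) (*-zeroʳ (R b i))))))) ,
  (λ ()) , λ ()
split (suc N) f X R C rows columns =
  let b₀ = f zero
      count₀ = cong (_+ count (f ∘ suc) b₀) (δ-refl b₀)
      Y₀ , Y₀≤X , rowsY₀ , columnsY₀ , columns-rest = Peel.peel (X b₀) (count (f ∘ suc) b₀) (R b₀) (C b₀)
        (λ i → trans (rows b₀ i) (cong (R b₀ i *_) count₀))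
        (λ j → ≤-trans (columns b₀ j) (≤-reflexive (cong (C b₀ j *_) count₀)))
      module S = Step f X R C rows columns Y₀ Y₀≤X rowsY₀ columns-rest
      Y′ , sumY′ , rowsY′ , columnsY′ = split N (f ∘ suc) S.X′ R C S.rows′ S.columns′
  in
  (λ { zero → Y₀ ; (suc s) → Y′ s }) ,
  (λ b i j → trans (cong (δ b b₀ * Y₀ i j +_) (sumY′ b i j)) (m+[n∸m]≡n (S.δY₀≤X b i j))) ,
  (λ { zero → rowsY₀ ; (suc s) → rowsY′ s }) ,
  λ { zero → columnsY₀ ; (suc s) → columnsY′ s }

-- Tableaux from indicator arrays

δ-≢ : ∀ {n} {i j : Fin n} → i ≢ j → δ i j ≡ 0
δ-≢ {i = i} {j} i≢j = cong ⟦_⟧ (dec-false (i Finₚ.≟ j) i≢j)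

δ-sym : ∀ {n} (i j : Fin n) → δ i j ≡ δ j i
δ-sym i j with i Finₚ.≟ j
... | yes refl = sym (δ-refl i)
... | no  i≢j  = sym (δ-≢ (i≢j ∘ sym))

sum-fibres : ∀ {N n} (f : Fin N → Fin n) (g : Fin N → ℕ) → sum (λ b → sum (λ s → δ b (f s) * g s)) ≡ sum g
sum-fibres f g = trans (∑-comm λ b s → δ b (f s) * g s)
  (sum-cong-≗ λ s → trans (sum-cong-≗ λ b → cong (_* g s) (δ-sym b (f s))) (sum-δ (f s) λ _ → g s))

two-terms≤sum : ∀ {n} (f : Fin n → ℕ) {i j} → i ≢ j → f i + f j ≤ sum f
two-terms≤sum f {zero}  {zero}  i≢j = contradiction refl i≢j
two-terms≤sum f {zero}  {suc j} i≢j = +-monoʳ-≤ (f zero) (term≤sum (f ∘ suc) j)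
two-terms≤sum f {suc i} {zero}  i≢j = ≤-trans (≤-reflexive (+-comm (f (suc i)) _)) (+-monoʳ-≤ (f zero) (term≤sum (f ∘ suc) i))
two-terms≤sum f {suc i} {suc j} i≢j = ≤-trans (two-terms≤sum (f ∘ suc) (i≢j ∘ cong suc)) (m≤n+m _ (f zero))

unit-sum : ∀ {n} (f : Fin n → ℕ) → sum f ≡ 1 → ∃ λ i → ∀ j → f j ≡ δ i j
unit-sum {suc n} f Σ≡1 with f zero in eq
... | zero with unit-sum (f ∘ suc) Σ≡1
... | i , f≗δ = suc i , λ { zero → eq ; (suc j) → trans (f≗δ j) (sym (δ-suc i j)) }
unit-sum {suc n} f Σ≡1 | suc k = zero , λ where
    zero    → trans eq (cong suc (m+n≡0⇒m≡0 k (suc-injective Σ≡1)))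
    (suc j) → n≤0⇒n≡0 (≤-trans (term≤sum (f ∘ suc) j) (≤-reflexive (m+n≡0⇒n≡0 k (suc-injective Σ≡1))))

⟦false⟧* : ∀ {b} → b ≡ false → ∀ n → ⟦ b ⟧ * n ≡ 0
⟦false⟧* refl n = refl

⟦true⟧* : ∀ {b} → b ≡ true → ∀ n → ⟦ b ⟧ * n ≡ n
⟦true⟧* refl n = *-identityˡ n

length-filter-∷ : ∀ {A : Set} {P : A → Set} (P? : Decidable P) x xs →
  length (filter P? (x ∷ xs)) ≡ ⟦ does (P? x) ⟧ + length (filter P? xs)
length-filter-∷ P? x xs with does (P? x)
... | true  = refl
... | false = refl

length-filter-map : ∀ {A B : Set} {P : B → Set} (P? : Decidable P) (g : A → B) xs →
  length (filter P? (map g xs)) ≡ length (filter (λ x → P? (g x)) xs)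
length-filter-map P? g []       = refl
length-filter-map P? g (x ∷ xs) = trans (length-filter-∷ P? (g x) (map g xs))
  (trans (cong (⟦ does (P? (g x)) ⟧ +_) (length-filter-map P? g xs)) (sym (length-filter-∷ (λ x → P? (g x)) x xs)))

length-filter-upTo : ∀ {N} {P : ℕ → Set} (P? : Decidable P) (g : ℕ → ℕ) x → x ≤ N →
  length (filter P? (applyUpTo g x)) ≡ sum {N} λ c → ⟦ does (toℕ c <? x) ⟧ * ⟦ does (P? (g (toℕ c))) ⟧
length-filter-upTo {N} P? g zero x≤N = sym (sum-zero {N} {λ c → ⟦ does (toℕ c <? 0) ⟧ * ⟦ does (P? (g (toℕ c))) ⟧} λ _ → refl)
length-filter-upTo {suc N} P? g (suc x) (s≤s x≤N) =
  trans (length-filter-∷ P? (g 0) (applyUpTo (g ∘ suc) x))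
    (cong₂ _+_ (sym (*-identityˡ ⟦ does (P? (g 0)) ⟧))
      (length-filter-upTo P? (g ∘ suc) x x≤N))

length-filter-rowLen : ∀ {P : ℕ → Set} (P? : Decidable P) xs →
  length (filter P? xs) ≡ sum {length xs} λ r → ⟦ does (P? (rowLen xs (toℕ r))) ⟧
length-filter-rowLen P? []       = refl
length-filter-rowLen P? (x ∷ xs) = trans (length-filter-∷ P? x xs) (cong (⟦ does (P? x) ⟧ +_) (length-filter-rowLen P? xs))

rowLen-map-upTo : ∀ (h : ℕ → ℕ) (g : ℕ → ℕ) L i → i < L → rowLen (map h (applyUpTo g L)) i ≡ h (g i)
rowLen-map-upTo h g (suc L) zero    _         = refl
rowLen-map-upTo h g (suc L) (suc i) (s≤s i<L) = rowLen-map-upTo h (g ∘ suc) L i i<L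

rowLen-map-upTo-≥ : ∀ (h : ℕ → ℕ) (g : ℕ → ℕ) L i → L ≤ i → rowLen (map h (applyUpTo g L)) i ≡ 0
rowLen-map-upTo-≥ h g zero    i       _         = refl
rowLen-map-upTo-≥ h g (suc L) (suc i) (s≤s L≤i) = rowLen-map-upTo-≥ h (g ∘ suc) L i L≤i

rowLen-pos⇒< : ∀ xs r {c} → c < rowLen xs r → r < length xs
rowLen-pos⇒< (x ∷ xs) zero    _ = s≤s z≤n
rowLen-pos⇒< (x ∷ xs) (suc r) h = s≤s (rowLen-pos⇒< xs r h)

-- Z r c s is the indicator of the symbol s + 1 standing in row r and column c.
module FromIndicator (lam : List ℕ) (N : ℕ) (largest≡N : largest lam ≡ N)
  (rows≤N : ∀ r → rowLen lam r ≤ N)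
  (Z : Fin (length lam) → Matrix N N)
  (cell-sum : ∀ r c → sum (Z r c) ≡ ⟦ does (toℕ c <? rowLen lam (toℕ r)) ⟧)
  (row-sum : ∀ r s → sum (λ c → Z r c s) ≡ ⟦ does (toℕ s <? rowLen lam (toℕ r)) ⟧)
  (column-sum : ∀ c s → sum (λ r → Z r c s) ≤ 1)
  where

  M : ℕ
  M = length lam

  In : Fin M → Fin N → Set
  In r c = toℕ c < rowLen lam (toℕ r)

  Z-unit : ∀ r c → In r c → ∃ λ s → ∀ j → Z r c j ≡ δ s j
  Z-unit r c c∈r = unit-sum (Z r c) (trans (cell-sum r c) (cong ⟦_⟧ (dec-true (toℕ c <? rowLen lam (toℕ r)) c∈r)))

  symbol : ∀ r c → Dec (In r c) → ℕ
  symbol r c (yes c∈r) = suc (toℕ (proj₁ (Z-unit r c c∈r)))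
  -- Symbols start at 1, so 0 marks a position outside the shape.
  symbol r c (no  _)   = 0

  entry : Fin M → Fin N → ℕ
  entry r c = symbol r c (toℕ c <? rowLen lam (toℕ r))

  T : ℕ → ℕ → ℕ
  T r c with r <? M | c <? N
  ... | yes r<M | yes c<N = entry (fromℕ< r<M) (fromℕ< c<N)
  ... | yes _   | no _    = 0
  ... | no _    | _       = 0

  T-toℕ : ∀ r c → T (toℕ r) (toℕ c) ≡ entry r c
  T-toℕ r c with toℕ r <? M | toℕ c <? N
  ... | yes r<M | yes c<N = cong₂ entry (Finₚ.fromℕ<-toℕ r r<M) (Finₚ.fromℕ<-toℕ c c<N)
  ... | yes _   | no c≮N  = contradiction (Finₚ.toℕ<n c) c≮N
  ... | no r≮M  | _       = contradiction (Finₚ.toℕ<n r) r≮M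

  entry-spec : ∀ r c → In r c → ∃ λ s → entry r c ≡ suc (toℕ s) × (∀ j → Z r c j ≡ δ s j)
  entry-spec r c c∈r with toℕ c <? rowLen lam (toℕ r)
  ... | yes h = proj₁ (Z-unit r c h) , refl , proj₂ (Z-unit r c h)
  ... | no ¬h = contradiction c∈r ¬h

  InShape : ℕ → ℕ → Set
  InShape r c = ∃ λ (r′ : Fin M) → ∃ λ (c′ : Fin N) → r ≡ toℕ r′ × c ≡ toℕ c′

  in-shape : ∀ {r c} → c < rowLen lam r → InShape r c
  in-shape {r} {c} h = fromℕ< r<M , fromℕ< c<N , sym (Finₚ.toℕ-fromℕ< r<M) , sym (Finₚ.toℕ-fromℕ< c<N)
    where
    r<M : r < M
    r<M = rowLen-pos⇒< lam r h
    c<N : c < N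
    c<N = <-≤-trans h (rows≤N r)

  row-sum≤1 : ∀ r s → sum (λ c → Z r c s) ≤ 1
  row-sum≤1 r s = ≤-trans (≤-reflexive (row-sum r s)) (⟦⟧≤1 _)
    where
    ⟦⟧≤1 : ∀ b → ⟦ b ⟧ ≤ 1
    ⟦⟧≤1 false = z≤n
    ⟦⟧≤1 true  = ≤-refl

  entry-Z : ∀ {r c s} → In r c → entry r c ≡ suc (toℕ s) → Z r c s ≡ 1
  entry-Z {r} {c} {s} c∈r eq with entry-spec r c c∈r
  ... | s₀ , eq₀ , Z≗δ rewrite Finₚ.toℕ-injective (suc-injective (trans (sym eq₀) eq)) = trans (Z≗δ s) (δ-refl s)

  not-twice : ∀ {k} (f : Fin k → ℕ) → sum f ≤ 1 → ∀ {i j} → i ≢ j → f i ≡ 1 → f j ≡ 1 → 2 ≤ 1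
  not-twice f Σ≤1 i≢j fi fj = ≤-trans (≤-reflexive (sym (cong₂ _+_ fi fj))) (≤-trans (two-terms≤sum f i≢j) Σ≤1)

  positive : ∀ r c → c < rowLen lam r → 0 < T r c
  positive r c h with in-shape h
  ... | r′ , c′ , refl , refl with entry-spec r′ c′ h
  ... | s , eq , _ = ≤-trans (s≤s z≤n) (≤-reflexive (sym (trans (T-toℕ r′ c′) eq)))

  row-distinct : ∀ r c c′ → c < rowLen lam r → c′ < rowLen lam r → c ≢ c′ → T r c ≢ T r c′
  row-distinct r c c′ h h′ c≢c′ eq with in-shape h | in-shape h′
  ... | r₁ , c₁ , refl , refl | r₂ , c₂ , eqr , refl with Finₚ.toℕ-injective eqr
  ... | refl with entry-spec r₁ c₁ h
  ... | s , eqs , _ = contradiction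
    (not-twice (λ c → Z r₁ c s) (row-sum≤1 r₁ s) {c₁} {c₂} (c≢c′ ∘ cong toℕ) (entry-Z h eqs)
      (entry-Z h′ (trans (sym (T-toℕ r₁ c₂)) (trans (sym eq) (trans (T-toℕ r₁ c₁) eqs)))))
    λ { (s≤s ()) }

  column-distinct : ∀ r r′ c → c < rowLen lam r → c < rowLen lam r′ → r ≢ r′ → T r c ≢ T r′ c
  column-distinct r r′ c h h′ r≢r′ eq with in-shape h | in-shape h′
  ... | r₁ , c₁ , refl , refl | r₂ , c₂ , refl , eqc with Finₚ.toℕ-injective eqc
  ... | refl with entry-spec r₁ c₁ h
  ... | s , eqs , _ = contradiction
    (not-twice (λ r → Z r c₁ s) (column-sum c₁ s) {r₁} {r₂} (r≢r′ ∘ cong toℕ) (entry-Z h eqs)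
      (entry-Z h′ (trans (sym (T-toℕ r₂ c₁)) (trans (sym eq) (trans (T-toℕ r₁ c₁) eqs)))))
    λ { (s≤s ()) }

  hits : ℕ → ℕ → ℕ → ℕ
  hits i r x = length (filter (λ c → T r c ≟ i) (upTo x))

  occurrences-rows : ∀ i k xs →
    length (filter (λ rc → T (proj₁ rc) (proj₂ rc) ≟ i) (cellsFrom k xs)) ≡ sum {length xs} λ r → hits i (k + toℕ r) (rowLen xs (toℕ r))
  occurrences-rows i k []       = refl
  occurrences-rows i k (x ∷ xs) = begin
    length (filter P? (map (k ,_) (upTo x) ++ cellsFrom (suc k) xs))
      ≡⟨ cong length (Listₚ.filter-++ P? (map (k ,_) (upTo x)) _) ⟩
    length (filter P? (map (k ,_) (upTo x)) ++ filter P? (cellsFrom (suc k) xs))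
      ≡⟨ Listₚ.length-++ (filter P? (map (k ,_) (upTo x))) ⟩
    length (filter P? (map (k ,_) (upTo x))) + length (filter P? (cellsFrom (suc k) xs))
      ≡⟨ cong₂ _+_ (length-filter-map P? (k ,_) (upTo x)) (occurrences-rows i (suc k) xs) ⟩
    hits i k x + sum {length xs} (λ r → hits i (suc k + toℕ r) (rowLen xs (toℕ r)))
      ≡⟨ cong₂ _+_ (cong (λ k → hits i k x) (+-identityʳ k))
           (sum-cong-≗ {length xs} λ r → cong (λ k → hits i k (rowLen xs (toℕ r))) (+-suc k (toℕ r))) ⟨
    sum {suc (length xs)} (λ r → hits i (k + toℕ r) (rowLen (x ∷ xs) (toℕ r))) ∎
    where
    open ≡-Reasoning
    P? = λ (rc : ℕ × ℕ) → T (proj₁ rc) (proj₂ rc) ≟ i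

  occurrences-cells : ∀ i → occurrences lam T i ≡
    sum {M} λ r → sum {N} λ c → ⟦ does (toℕ c <? rowLen lam (toℕ r)) ⟧ * ⟦ does (T (toℕ r) (toℕ c) ≟ i) ⟧
  occurrences-cells i = trans (occurrences-rows i 0 lam)
    (sum-cong-≗ {M} λ r → length-filter-upTo (λ c → T (toℕ r) c ≟ i) id (rowLen lam (toℕ r)) (rows≤N (toℕ r)))

  cell-count : ∀ s r c → ⟦ does (toℕ c <? rowLen lam (toℕ r)) ⟧ * ⟦ does (T (toℕ r) (toℕ c) ≟ suc (toℕ s)) ⟧ ≡ Z r c s
  cell-count s r c = by-cases (toℕ c <? rowLen lam (toℕ r))
    where
    outside : ¬ In r c → does (toℕ c <? rowLen lam (toℕ r)) ≡ false
    outside = dec-false (toℕ c <? rowLen lam (toℕ r))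
    equality : ∀ {s₀} → entry r c ≡ suc (toℕ s₀) → ⟦ does (T (toℕ r) (toℕ c) ≟ suc (toℕ s)) ⟧ ≡ δ s₀ s
    equality {s₀} eq with s₀ Finₚ.≟ s
    ... | yes refl = cong ⟦_⟧ (dec-true (T (toℕ r) (toℕ c) ≟ suc (toℕ s)) (trans (T-toℕ r c) eq))
    ... | no s₀≢s  = cong ⟦_⟧ (dec-false (T (toℕ r) (toℕ c) ≟ suc (toℕ s))
      λ h → s₀≢s (Finₚ.toℕ-injective (suc-injective (trans (sym eq) (trans (sym (T-toℕ r c)) h)))))
    by-cases : Dec (In r c) → ⟦ does (toℕ c <? rowLen lam (toℕ r)) ⟧ * ⟦ does (T (toℕ r) (toℕ c) ≟ suc (toℕ s)) ⟧ ≡ Z r c s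
    by-cases (no c∉r) = trans (⟦false⟧* (outside c∉r) _)
      (sym (n≤0⇒n≡0 (≤-trans (term≤sum (Z r c) s) (≤-reflexive (trans (cell-sum r c) (cong ⟦_⟧ (outside c∉r)))))))
    by-cases (yes c∈r) with entry-spec r c c∈r
    ... | s₀ , eq , Z≗δ = trans (⟦true⟧* (dec-true (toℕ c <? rowLen lam (toℕ r)) c∈r) _)
      (trans (equality eq) (sym (Z≗δ s)))

  -- By the row sums, a row contains the symbol i + 1 exactly when its length exceeds i, and the
  -- number of such rows is the entry of the conjugate. From `N` on both sides vanish.
  content : ∀ i → occurrences lam T (suc i) ≡ rowLen (conj lam) i
  content i with i <? N
  ... | yes i<N = begin
    occurrences lam T (suc i)
      ≡⟨ cong (λ k → occurrences lam T (suc k)) (Finₚ.toℕ-fromℕ< i<N) ⟨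
    occurrences lam T (suc (toℕ s))
      ≡⟨ occurrences-cells (suc (toℕ s)) ⟩
    sum {M} (λ r → sum {N} λ c → ⟦ does (toℕ c <? rowLen lam (toℕ r)) ⟧ * ⟦ does (T (toℕ r) (toℕ c) ≟ suc (toℕ s)) ⟧)
      ≡⟨ sum-cong-≗ (λ r → trans (sum-cong-≗ (cell-count s r)) (row-sum r s)) ⟩
    sum {M} (λ r → ⟦ does (toℕ s <? rowLen lam (toℕ r)) ⟧)
      ≡⟨ cong (λ k → sum {M} λ r → ⟦ does (k <? rowLen lam (toℕ r)) ⟧) (Finₚ.toℕ-fromℕ< i<N) ⟩
    sum {M} (λ r → ⟦ does (suc i ≤? rowLen lam (toℕ r)) ⟧)
      ≡⟨ length-filter-rowLen (suc i ≤?_) lam ⟨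
    length (filter (suc i ≤?_) lam)
      ≡⟨ rowLen-map-upTo (λ i → length (filter (suc i ≤?_) lam)) id (largest lam) i (subst (i <_) (sym largest≡N) i<N) ⟨
    rowLen (conj lam) i ∎
    where
    open ≡-Reasoning
    s : Fin N
    s = fromℕ< i<N
  ... | no i≮N = trans (trans (occurrences-cells (suc i)) (sum-zero λ r → sum-zero (absent r)))
    (sym (rowLen-map-upTo-≥ (λ i → length (filter (suc i ≤?_) lam)) id (largest lam) i (subst (_≤ i) (sym largest≡N) (≮⇒≥ i≮N))))
    where
    absent : ∀ r c → ⟦ does (toℕ c <? rowLen lam (toℕ r)) ⟧ * ⟦ does (T (toℕ r) (toℕ c) ≟ suc i) ⟧ ≡ 0
    absent r c = by-cases (toℕ c <? rowLen lam (toℕ r))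
      where
      by-cases : Dec (In r c) → ⟦ does (toℕ c <? rowLen lam (toℕ r)) ⟧ * ⟦ does (T (toℕ r) (toℕ c) ≟ suc i) ⟧ ≡ 0
      by-cases (no c∉r) = ⟦false⟧* (dec-false (toℕ c <? rowLen lam (toℕ r)) c∉r) _
      by-cases (yes c∈r) with entry-spec r c c∈r
      ... | s , eq , _ = trans (*-comm ⟦ does (toℕ c <? rowLen lam (toℕ r)) ⟧ _) (⟦false⟧* (dec-false (T (toℕ r) (toℕ c) ≟ suc i)
        λ h → i≮N (subst (_< N) (suc-injective (trans (sym eq) (trans (sym (T-toℕ r c)) h))) (Finₚ.toℕ<n s))) _)

  latin : Latin lam
  latin = T , positive , row-distinct , column-distinct , content

-- Tableaux from block counts

-- Rows are grouped by ρ, and columns and symbols by κ; a row of group k meets the columns of group a, and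
-- uses the symbols of group a, iff P k a. X k a b counts the symbols of group b in the rows of group k and columns of group a.
module FromOutline (lam : List ℕ) (N : ℕ) (largest≡N : largest lam ≡ N) (rows≤N : ∀ r → rowLen lam r ≤ N)
  {n : ℕ} (ρ : Fin (length lam) → Fin n) (κ : Fin N → Fin n) (P : Fin n → Fin n → Bool)
  (shape : ∀ r c → P (ρ r) (κ c) ≡ does (toℕ c <? rowLen lam (toℕ r)))
  (X : Fin n → Matrix n n)
  (rowsX : ∀ k a → sum (X k a) ≡ ⟦ P k a ⟧ * count κ a * count ρ k)
  (columnsX : ∀ k b → sum (λ a → X k a b) ≡ ⟦ P k b ⟧ * count κ b * count ρ k)
  (capacityX : ∀ a b → sum (λ k → X k a b) ≤ count κ a * count κ b)
  where

  M : ℕ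
  M = length lam

  latin : Latin lam
  latin =
    -- `XA r a b` counts the symbols of block `b` in row `r` and the columns of block `a`. The split
    -- only bounds its column sums; `columnsA≡` recovers equality since the totals of each row
    -- agree.
    let XA , fibresA , rowsA , columnsA = split M ρ X (λ k a → ⟦ P k a ⟧ * count κ a) (λ k b → ⟦ P k b ⟧ * count κ b)
          rowsX (λ k b → ≤-reflexive (columnsX k b))
        columnsA≡ : ∀ r b → sum (λ a → XA r a b) ≡ ⟦ P (ρ r) b ⟧ * count κ b
        columnsA≡ r b = sum-squeeze (columnsA r) (≤-reflexive (trans (sum-cong-≗ λ a → sym (rowsA r a)) (∑-comm (XA r)))) b
        capacityA : ∀ a b → sum (λ r → XA r a b) ≤ count κ a * count κ b
        capacityA a b = ≤-trans (≤-reflexive (trans (sym (sum-fibres ρ λ r → XA r a b)) (sum-cong-≗ λ k → fibresA k a b))) (capacityX a b)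
        -- Now the symbols are the slices and the tableau rows are the matrix rows. `Y s r a` counts
        -- the symbol `s` in row `r` and block `a`; the capacity becomes the condition that `s`
        -- occurs in block `a` at most as often as the block has columns.
        Y , fibresY , rowsY , columnsY = split N κ (λ b r a → XA r a b) (λ b r → ⟦ P (ρ r) b ⟧) (λ b a → count κ a)
          (λ b r → columnsA≡ r b) (λ b a → capacityA a b)
        rowsY′ : ∀ a r → sum (λ s → Y s r a) ≡ ⟦ P (ρ r) a ⟧ * count κ a
        rowsY′ a r = trans (sym (sum-fibres κ λ s → Y s r a)) (trans (sum-cong-≗ λ b → fibresY b r a) (rowsA r a))
        -- That condition is what the last split, into columns, consumes: its column bound 1 says
        -- that no symbol repeats in a column.
        Z , fibresZ , rowsZ , columnsZ = split N κ (λ a r s → Y s r a) (λ a r → ⟦ P (ρ r) a ⟧) (λ a s → 1)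
          rowsY′ (λ a s → ≤-trans (columnsY s a) (≤-reflexive (sym (*-identityˡ (count κ a)))))
    in FromIndicator.latin lam N largest≡N rows≤N (λ r c s → Z c r s)
         (λ r c → trans (rowsZ c r) (cong ⟦_⟧ (shape r c)))
         (λ r s → trans (sym (sum-fibres κ λ c → Z c r s))
            (trans (sum-cong-≗ λ a → fibresZ a r s) (trans (rowsY s r) (cong ⟦_⟧ (shape r s)))))
         (λ c s → columnsZ c s)

-- Block counts for the shorter rows

-- Derives L ≤ R from l ≤ r, where the polynomial identity R - L = (r - l) + slack is stated without subtraction.
by : ∀ {l r L R} → l ≤ r → ∀ slack → L + r + slack ≡ R + l → L ≤ R
by {l} {r} {L} {R} l≤r slack eq = +-cancelʳ-≤ r L R (begin
  L + r           ≤⟨ m≤m+n (L + r) slack ⟩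
  L + r + slack   ≡⟨ eq ⟩
  R + l           ≤⟨ +-monoʳ-≤ R l≤r ⟩
  R + r           ∎)
  where open ≤-Reasoning

infixl 6 _⊕_
_⊕_ : ∀ {a b c d} → a ≤ b → c ≤ d → a + c ≤ b + d
_⊕_ = +-mono-≤

eq-≤ : ∀ {a b : ℕ} → a ≡ b → a ≤ b
eq-≤ = ≤-reflexive

eq-≥ : ∀ {a b : ℕ} → a ≡ b → b ≤ a
eq-≥ eq = ≤-reflexive (sym eq)

mulʳ : ∀ {a b} c → a ≤ b → a * c ≤ b * c
mulʳ c = *-monoˡ-≤ c

mulˡ : ∀ {a b} c → a ≤ b → c * a ≤ c * b
mulˡ c = *-monoʳ-≤ c

-- Dominance for a^m b c^r d and a^m c^r d, where x, y, z, u are a - b, b - c, c - d, d.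
record WideIneqs (x y z u r m : ℕ) : Set where
  field
    with-b-at-d  : (m + 2 + r) * u ≤ m * x + (m + 1) * y + z * u + u * u
    with-b-at-d′ : (m + 2 + r) * u ≤ m * x + (m + 1) * y + z * (m + 1 + r) + u * u
    sans-b-at-d  : (m + 1 + r) * u ≤ m * x + m * y + z * u + u * u
    sans-b-at-d′ : (m + 1 + r) * u ≤ m * x + m * y + z * (m + r) + u * u
    with-b-at-z  : (m + 1 + r) * z + z ⊓ u ≤ m * x + (m + 1) * y + z * z + u * z
    sans-b-at-z  : (m + r) * z + z ⊓ u ≤ m * x + m * y + z * z + u * z
    with-b-at-c  : (m + 1 + r) * (z + u) + u ≤ m * x + (m + 1) * y + (z + u) * (z + u)

-- The entries p and q count, block by block, the cells of the row of length b and of the rows of length c.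
record IsPlan (x y z u r m puu puz puy pzz pzy pyy quu quz qzz : ℕ) : Set where
  field
    p-u : puu + puz + puy ≡ u
    p-z : puz + pzz + pzy ≡ z
    p-y : puy + pzy + pyy ≡ y
    q-u : quu + quz ≡ r * u
    q-z : quz + qzz ≡ r * z
    cap-uu : puu + quu + u ≤ u * u
    cap-uz : puz + quz ≤ u * z
    cap-zz : pzz + qzz ≤ z * z
    cut-u-u   : m < u → m * u + (puu + quu + u) ≤ u * u + m * (x + y + z)
    cut-z-z   : m < z → m * z + (pzz + qzz) ≤ z * z + m * (x + y + u)
    cut-u-uz  : m * u + (2 + r) * u ≤ puy + u * (z + u) + m * (x + y)
    cut-z-uz  : m * z + (1 + r) * z ≤ pzy + z * (z + u) + m * (x + y)
    cut-uz-uz : (m + 1 + r) * (z + u) + u ≤ puy + pzy + (z + u) * (z + u) + m * (x + y)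

record Plan (x y z u r m : ℕ) : Set where
  field
    {puu puz puy pzz pzy pyy quu quz qzz} : ℕ
    isPlan : IsPlan x y z u r m puu puz puy pzz pzy pyy quu quz qzz

-- A single row puts at most the minimum of `s` and `t` symbols of a block of size `t` into a block
-- of `s` columns, so one row alone never exceeds the capacity.
≤-* : ∀ {k s t} → k ≤ s → k ≤ t → k ≤ s * t
≤-* {s = zero}  k≤s k≤t = k≤s
≤-* {s = suc s} {t} k≤s k≤t = ≤-trans k≤t (m≤m+n t (s * t))

module _ {x y z u r m : ℕ} (0<u : 0 < u) (r+1≤c : r + 1 ≤ z + u) where

  -- quz is made as large as the capacity u * z allows.
  finish : ∀ puu puz puy pzz pzy pyy →
    puu + puz + puy ≡ u → puz + pzz + pzy ≡ z → puy + pzy + pyy ≡ y →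
    m * u + (2 + r) * u ≤ puy + u * (z + u) + m * (x + y) →
    m * z + (1 + r) * z ≤ pzy + z * (z + u) + m * (x + y) →
    (m + 1 + r) * (z + u) + u ≤ puy + pzy + (z + u) * (z + u) + m * (x + y) →
    (2 + r) * u ≤ puy + u * (z + u) →
    puu + (r + 1) * u ≤ u * u + r * z →
    m * u + (puu + (r + 1) * u) ≤ u * u + r * z + m * (x + y + z) →
    (u < z → puu ≡ 0) →
    (u < z → z ≤ m + r → m * z + pzz + r * z ≤ z * z + r * u + m * (x + y + u)) →
    Plan x y z u r m
  finish puu puz puy pzz pzy pyy p-u p-z p-y cut₁ cut₂ cut₃ cap₁ cap₂ cut₄ puu≡0 cut₅ = by-cases (z ≤? u) (u * z ≤? puz + r * (z ⊓ u))
    where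
    puz≤uz : puz ≤ u * z
    puz≤uz = ≤-* {puz} {u} {z} (by (eq-≤ p-u) (puu + puy) (solve (puu ∷ puz ∷ puy ∷ u ∷ [])))
                 (by (eq-≤ p-z) (pzz + pzy) (solve (pzz ∷ puz ∷ pzy ∷ z ∷ [])))
    pzz≤z : pzz ≤ z
    pzz≤z = by (eq-≤ p-z) (puz + pzy) (solve (pzz ∷ puz ∷ pzy ∷ z ∷ []))

    -- With the u-z pairs used up, the margins express `puu + quu + u` and `pzz + qzz` through `puy`
    -- and `pzy`; capacities and cuts reduce to hypotheses free of the counts q.
    full-case : ∀ quz quu qzz → puz + quz ≡ u * z → quu + quz ≡ r * u → quz + qzz ≡ r * z → Plan x y z u r m
    full-case quz quu qzz Uuz q-u q-z = record
      { puu = puu ; puz = puz ; puy = puy ; pzz = pzz ; pzy = pzy ; pyy = pyy ; quu = quu ; quz = quz ; qzz = qzz ; isPlan = record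
      { p-u = p-u ; p-z = p-z ; p-y = p-y ; q-u = q-u ; q-z = q-z
      ; cap-uu = by (cap₁ ⊕ eq-≥ Uuz ⊕ eq-≤ p-u ⊕ eq-≤ q-u) 0 (solve (puu ∷ puz ∷ puy ∷ quu ∷ quz ∷ u ∷ z ∷ r ∷ []))
      ; cap-uz = eq-≤ Uuz
      ; cap-zz = by (mulʳ z r+1≤c ⊕ eq-≥ Uuz ⊕ eq-≤ p-z ⊕ eq-≤ q-z) pzy (solve (puz ∷ pzz ∷ pzy ∷ qzz ∷ quz ∷ u ∷ z ∷ r ∷ []))
      ; cut-u-u = λ _ → by (cut₁ ⊕ eq-≥ Uuz ⊕ eq-≤ p-u ⊕ eq-≤ q-u) (m * z) (solve (puu ∷ puz ∷ puy ∷ quu ∷ quz ∷ u ∷ z ∷ x ∷ y ∷ m ∷ r ∷ []))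
      ; cut-z-z = λ _ → by (cut₂ ⊕ eq-≥ Uuz ⊕ eq-≤ p-z ⊕ eq-≤ q-z) (m * u) (solve (puz ∷ pzz ∷ pzy ∷ qzz ∷ quz ∷ u ∷ z ∷ x ∷ y ∷ m ∷ r ∷ []))
      ; cut-u-uz = cut₁ ; cut-z-uz = cut₂ ; cut-uz-uz = cut₃ } }

    -- Used for z ≤ u when the capacity is no obstacle: in the rows c^r the z-columns receive only
    -- u-symbols, which leaves `qzz = 0`.
    sparse-case≤ : ∀ quu → quu + r * z ≡ r * u → puz + r * z ≤ u * z → Plan x y z u r m
    sparse-case≤ quu q-u puz+rz≤uz = record
      { puu = puu ; puz = puz ; puy = puy ; pzz = pzz ; pzy = pzy ; pyy = pyy ; quu = quu ; quz = r * z ; qzz = 0 ; isPlan = record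
      { p-u = p-u ; p-z = p-z ; p-y = p-y ; q-u = q-u ; q-z = +-identityʳ _
      ; cap-uu = by (cap₂ ⊕ eq-≤ q-u) 0 (solve (puu ∷ quu ∷ u ∷ z ∷ r ∷ []))
      ; cap-uz = puz+rz≤uz
      ; cap-zz = ≤-trans (≤-reflexive (+-identityʳ pzz)) (≤-* pzz≤z pzz≤z)
      ; cut-u-u = λ _ → by (cut₄ ⊕ eq-≤ q-u) 0 (solve (puu ∷ quu ∷ u ∷ z ∷ x ∷ y ∷ m ∷ r ∷ []))
      ; cut-z-z = λ m<z → by (mulʳ z m<z ⊕ pzz≤z) (m * (x + y + u)) (solve (pzz ∷ u ∷ z ∷ x ∷ y ∷ m ∷ []))
      ; cut-u-uz = cut₁ ; cut-z-uz = cut₂ ; cut-uz-uz = cut₃ } }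

    -- For u < z the u-columns of the rows c^r receive only z-symbols, so `quu = 0`, and `puu`
    -- vanishes too. The excess `r * z - r * u` falls on the z-z pairs.
    sparse-case> : ∀ qzz → u < z → r * u + qzz ≡ r * z → puz + r * u ≤ u * z → Plan x y z u r m
    sparse-case> qzz u<z q-z puz+ru≤uz = record
      { puu = puu ; puz = puz ; puy = puy ; pzz = pzz ; pzy = pzy ; pyy = pyy ; quu = 0 ; quz = r * u ; qzz = qzz ; isPlan = record
      { p-u = p-u ; p-z = p-z ; p-y = p-y ; q-u = refl ; q-z = q-z
      ; cap-uu = ≤-trans (≤-reflexive (cong (λ v → v + 0 + u) puu0)) (≤-* ≤-refl ≤-refl)
      ; cap-uz = puz+ru≤uz
      ; cap-zz = cap-zz
      ; cut-u-u = λ m<u → by (mulʳ u m<u ⊕ eq-≤ puu0) (m * (x + y + z)) (solve (puu ∷ u ∷ z ∷ x ∷ y ∷ m ∷ []))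
      ; cut-z-z = cut-z-z
      ; cut-u-uz = cut₁ ; cut-z-uz = cut₂ ; cut-uz-uz = cut₃ } }
      where
      puu0 : puu ≡ 0
      puu0 = puu≡0 u<z
      cap-zz : pzz + qzz ≤ z * z
      cap-zz with r <? z
      ... | yes r<z = by (mulʳ z r<z ⊕ eq-≤ q-z ⊕ pzz≤z) (r * u) (solve (pzz ∷ qzz ∷ r ∷ z ∷ u ∷ []))
      ... | no r≮z = by (mulʳ z r≤z ⊕ mulʳ u (≮⇒≥ r≮z) ⊕ eq-≤ q-z ⊕ pzz≤z ⊕ mulˡ z 0<u) 0 (solve (pzz ∷ qzz ∷ r ∷ z ∷ u ∷ []))
        where
        r≤z : r ≤ z
        r≤z = *-cancelʳ-≤ r z u {{>-nonZero 0<u}} (≤-trans (m≤n+m (r * u) puz) (≤-trans puz+ru≤uz (≤-reflexive (*-comm u z))))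
      cut-z-z : m < z → m * z + (pzz + qzz) ≤ z * z + m * (x + y + u)
      cut-z-z m<z with z ≤? m + r
      ... | yes z≤m+r = by (cut₅ u<z z≤m+r ⊕ eq-≤ q-z) 0 (solve (pzz ∷ qzz ∷ u ∷ z ∷ x ∷ y ∷ m ∷ r ∷ []))
      -- Here m + r + 1 ≤ z, and m + r + 1 rows of z cells fit into `z * z`.
      ... | no  z≰m+r = by (mulʳ z (≰⇒> z≰m+r) ⊕ pzz≤z ⊕ eq-≤ q-z) (r * u + m * (x + y + u)) (solve (pzz ∷ qzz ∷ u ∷ z ∷ x ∷ y ∷ m ∷ r ∷ []))

    by-cases : Dec (z ≤ u) → Dec (u * z ≤ puz + r * (z ⊓ u)) → Plan x y z u r m
    by-cases _ (yes full) = full-case (u * z ∸ puz) (r * u ∸ quz) (r * z ∸ quz) (m+[n∸m]≡n puz≤uz)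
      (m∸n+n≡m (quz≤ (m⊓n≤n z u))) (m+[n∸m]≡n (quz≤ (m⊓n≤m z u)))
      where
      quz = u * z ∸ puz
      quz≤ : ∀ {v} → z ⊓ u ≤ v → quz ≤ r * v
      quz≤ {v} z⊓u≤v = ≤-trans (≤-trans (∸-monoˡ-≤ puz full) (≤-reflexive (m+n∸m≡n puz (r * (z ⊓ u))))) (*-monoʳ-≤ r z⊓u≤v)
    by-cases (yes z≤u) (no notfull) = sparse-case≤ (r * u ∸ r * z) (m∸n+n≡m (*-monoʳ-≤ r z≤u))
      (≤-trans (≤-reflexive (cong (λ v → puz + r * v) (sym (m≤n⇒m⊓n≡m z≤u)))) (<⇒≤ (≰⇒> notfull)))
    by-cases (no z≰u) (no notfull) = sparse-case> (r * z ∸ r * u) u<z (m+[n∸m]≡n (*-monoʳ-≤ r (<⇒≤ u<z)))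
      (≤-trans (≤-reflexive (cong (λ v → puz + r * v) (sym (m≥n⇒m⊓n≡n (<⇒≤ u<z))))) (<⇒≤ (≰⇒> notfull)))
      where
      u<z : u < z
      u<z = ≰⇒> z≰u

  -- The row b takes the block counts of i ↦ b + 1 - i. The first u columns are sent to the last u
  -- symbols, so the pairing changes form where y passes u - z, u and u + z.
  plan : WideIneqs x y z u r 0 → WideIneqs x y z u r m → Plan x y z u r m
  plan W₀ W = by-regime (y + z ≤? u) (y ≤? u) (y ≤? u + z)
    where
    open WideIneqs
    at-z≤ : z ≤ u → (m + r) * z + z ≤ m * x + m * y + z * z + u * z
    at-z≤ z≤u = subst (λ v → (m + r) * z + v ≤ m * x + m * y + z * z + u * z) (m≤n⇒m⊓n≡m z≤u) (sans-b-at-z W)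
    at-z> : u < z → (m + 1 + r) * z + u ≤ m * x + (m + 1) * y + z * z + u * z
    at-z> u<z = subst (λ v → (m + 1 + r) * z + v ≤ m * x + (m + 1) * y + z * z + u * z) (m≥n⇒m⊓n≡n (<⇒≤ u<z)) (with-b-at-z W)

    at-z : (m + r) * z ≤ m * x + m * y + z * z + u * z
    at-z = ≤-trans (m≤m+n _ (z ⊓ u)) (sans-b-at-z W)

    regime₁ : ∀ k → k + z + y ≡ u → z ≤ u → Plan x y z u r m
    regime₁ k eq-u z≤u = finish k z y 0 0 0 eq-u (solve (z ∷ [])) (solve (y ∷ []))
      (by (with-b-at-d W) 0 (solve (x ∷ y ∷ z ∷ u ∷ m ∷ r ∷ [])))
      (by (at-z≤ z≤u) 0 (solve (x ∷ y ∷ z ∷ u ∷ m ∷ r ∷ [])))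
      (by (with-b-at-c W) 0 (solve (x ∷ y ∷ z ∷ u ∷ m ∷ r ∷ [])))
      (by (with-b-at-d W₀) 0 (solve (x ∷ y ∷ z ∷ u ∷ r ∷ [])))
      (by (with-b-at-d′ W₀ ⊕ eq-≤ eq-u) 0 (solve (x ∷ y ∷ z ∷ u ∷ k ∷ r ∷ [])))
      (by (with-b-at-d′ W ⊕ eq-≤ eq-u) 0 (solve (x ∷ y ∷ z ∷ u ∷ k ∷ m ∷ r ∷ [])))
      (λ u<z → contradiction u<z (≤⇒≯ z≤u))
      (λ u<z → contradiction u<z (≤⇒≯ z≤u))

    regime₂ : ∀ k l → k + y ≡ u → k + l ≡ z → y ≤ u → Plan x y z u r m
    regime₂ k l eq-u eq-z y≤u = finish 0 k y l 0 0 eq-u (trans (+-identityʳ _) eq-z) (solve (y ∷ []))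
      (by (with-b-at-d W) 0 (solve (x ∷ y ∷ z ∷ u ∷ m ∷ r ∷ [])))
      cut₂
      (by (with-b-at-c W) 0 (solve (x ∷ y ∷ z ∷ u ∷ m ∷ r ∷ [])))
      (by (with-b-at-d W₀) 0 (solve (x ∷ y ∷ z ∷ u ∷ r ∷ [])))
      (by (sans-b-at-d′ W₀) 0 (solve (x ∷ y ∷ z ∷ u ∷ r ∷ [])))
      (by (sans-b-at-d′ W) 0 (solve (x ∷ y ∷ z ∷ u ∷ m ∷ r ∷ [])))
      (λ _ → refl)
      (λ u<z z≤m+r → by (at-z> u<z ⊕ mulˡ u z≤m+r ⊕ y≤u ⊕ eq-≥ eq-u ⊕ eq-≤ eq-z ⊕ y≤u) 0 (solve (x ∷ y ∷ z ∷ u ∷ k ∷ l ∷ m ∷ r ∷ [])))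
      where
      cut₂ : m * z + (1 + r) * z ≤ 0 + z * (z + u) + m * (x + y)
      -- At j = z the part d contributes `z ⊓ u` to the conjugate. If z ≤ u this is all of z and the
      -- inequality without b is the claim. Otherwise it is u, and the inequality with b has this u
      -- against the additional y ≤ u.
      cut₂ with z ≤? u
      ... | yes z≤u = by (at-z≤ z≤u) 0 (solve (x ∷ y ∷ z ∷ u ∷ m ∷ r ∷ []))
      ... | no  z≰u = by (at-z> (≰⇒> z≰u) ⊕ y≤u) 0 (solve (x ∷ y ∷ z ∷ u ∷ m ∷ r ∷ []))

    regime₃ : ∀ k l → u + k ≡ y → l + k ≡ z → Plan x y z u r m
    regime₃ k l eq-y eq-z = finish 0 0 u l k 0 refl eq-z (trans (+-identityʳ _) eq-y)
      (by (sans-b-at-d W) 0 (solve (x ∷ y ∷ z ∷ u ∷ m ∷ r ∷ [])))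
      cut₂
      (by (with-b-at-c W ⊕ eq-≥ eq-y) 0 (solve (x ∷ y ∷ z ∷ u ∷ k ∷ m ∷ r ∷ [])))
      (by (sans-b-at-d W₀) 0 (solve (x ∷ y ∷ z ∷ u ∷ r ∷ [])))
      (by (sans-b-at-d′ W₀) 0 (solve (x ∷ y ∷ z ∷ u ∷ r ∷ [])))
      (by (sans-b-at-d′ W) 0 (solve (x ∷ y ∷ z ∷ u ∷ m ∷ r ∷ [])))
      (λ _ → refl)
      (λ u<z z≤m+r → by (at-z> u<z ⊕ mulˡ u z≤m+r ⊕ eq-≤ eq-z ⊕ eq-≥ eq-y) 0 (solve (x ∷ y ∷ z ∷ u ∷ k ∷ l ∷ m ∷ r ∷ [])))
      where
      cut₂ : m * z + (1 + r) * z ≤ k + z * (z + u) + m * (x + y)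
      cut₂ with z ≤? u
      ... | yes z≤u = by (at-z≤ z≤u) k (solve (x ∷ y ∷ z ∷ u ∷ k ∷ m ∷ r ∷ []))
      ... | no  z≰u = by (at-z> (≰⇒> z≰u) ⊕ eq-≥ eq-y) 0 (solve (x ∷ y ∷ z ∷ u ∷ k ∷ m ∷ r ∷ []))

    regime₄ : ∀ k → u + z + k ≡ y → u + z ≤ y → Plan x y z u r m
    regime₄ k eq-y u+z≤y = finish 0 0 u 0 z k refl refl eq-y
      (by (sans-b-at-d W) 0 (solve (x ∷ y ∷ z ∷ u ∷ m ∷ r ∷ [])))
      (by at-z 0 (solve (x ∷ y ∷ z ∷ u ∷ m ∷ r ∷ [])))
      -- No dominance involving a is called for: `m * y` pays for the m long rows and `r + 1 ≤ c`
      -- for the others.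
      (by (mulˡ m u+z≤y ⊕ mulʳ (z + u) r+1≤c) (z + m * x) (solve (x ∷ y ∷ z ∷ u ∷ m ∷ r ∷ [])))
      (by (sans-b-at-d W₀) 0 (solve (x ∷ y ∷ z ∷ u ∷ r ∷ [])))
      (by (sans-b-at-d′ W₀) 0 (solve (x ∷ y ∷ z ∷ u ∷ r ∷ [])))
      (by (sans-b-at-d′ W) 0 (solve (x ∷ y ∷ z ∷ u ∷ m ∷ r ∷ [])))
      (λ _ → refl)
      (λ u<z z≤m+r → by (at-z ⊕ mulˡ u z≤m+r) 0 (solve (x ∷ y ∷ z ∷ u ∷ m ∷ r ∷ [])))

    by-regime : Dec (y + z ≤ u) → Dec (y ≤ u) → Dec (y ≤ u + z) → Plan x y z u r m
    by-regime (yes y+z≤u) _ _ = regime₁ (u ∸ (y + z)) (trans (+-assoc (u ∸ (y + z)) z y) (trans (cong (u ∸ (y + z) +_) (+-comm z y)) (m∸n+n≡m y+z≤u)))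
      (≤-trans (m≤n+m z y) y+z≤u)
    by-regime (no y+z≰u) (yes y≤u) _ = regime₂ (u ∸ y) (z ∸ (u ∸ y)) (m∸n+n≡m y≤u)
      (m+[n∸m]≡n (m≤n+o⇒m∸n≤o u y (<⇒≤ (≰⇒> y+z≰u)))) y≤u
    by-regime _ (no y≰u) (yes y≤u+z) = regime₃ (y ∸ u) (z ∸ (y ∸ u)) (m+[n∸m]≡n (<⇒≤ (≰⇒> y≰u)))
      (m∸n+n≡m (m≤n+o⇒m∸n≤o y u y≤u+z))
    by-regime _ (no _) (no y≰u+z) = regime₄ (y ∸ (u + z)) (m+[n∸m]≡n (<⇒≤ (≰⇒> y≰u+z))) (<⇒≤ (≰⇒> y≰u+z))

-- Block counts for the longest rows

weight≤sum : ∀ {n} (A : Subset n) f → weight A f ≤ sum f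
weight≤sum A f = sum-mono λ i → bit (lookup A i) (f i)
  where
  bit : ∀ b v → ⟦ b ⟧ * v ≤ v
  bit false v = z≤n
  bit true  v = ≤-reflexive (*-identityˡ v)

weight-scale : ∀ {n} (A : Subset n) k f → weight A (λ i → k * f i) ≡ k * weight A f
weight-scale A k f = trans (sum-cong-≗ λ i → swap (χ A i) k (f i)) (sym (*-distribˡ-sum k λ i → χ A i * f i))
  where
  swap : ∀ a b c → a * (b * c) ≡ b * (a * c)
  swap = solve-∀

rect-+ : ∀ {p q} (c d : Matrix p q) A B → rect (λ i j → c i j + d i j) A B ≡ rect c A B + rect d A B
rect-+ c d A B = trans (weight-cong A λ i → weight-+ B (c i) (d i)) (weight-+ A (λ i → weight B (c i)) (λ i → weight B (d i)))

rect-product : ∀ {p q} (v : Fin p → ℕ) (w : Fin q → ℕ) A B → rect (λ i j → v i * w j) A B ≡ weight A v * weight B w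
rect-product v w A B = begin
  weight A (λ i → weight B (λ j → v i * w j))   ≡⟨ weight-cong A (λ i → trans (weight-scale B (v i) w) (*-comm (v i) _)) ⟩
  weight A (λ i → weight B w * v i)             ≡⟨ weight-scale A (weight B w) v ⟩
  weight B w * weight A v                       ≡⟨ *-comm (weight B w) _ ⟩
  weight A v * weight B w                       ∎
  where open ≡-Reasoning

rect-symmetric : ∀ {n} (c : Matrix n n) → (∀ i j → c i j ≡ c j i) → ∀ A B → rect c A B ≡ rect c B A
rect-symmetric c c-sym A B = begin
  sum (λ i → χ A i * sum (λ j → χ B j * c i j))     ≡⟨ sum-cong-≗ (λ i → *-distribˡ-sum (χ A i) λ j → χ B j * c i j) ⟩
  sum (λ i → sum (λ j → χ A i * (χ B j * c i j)))   ≡⟨ ∑-comm (λ i j → χ A i * (χ B j * c i j)) ⟩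
  sum (λ j → sum (λ i → χ A i * (χ B j * c i j)))   ≡⟨ sum-cong-≗ (λ j → sum-cong-≗ λ i → trans (swap (χ A i) (χ B j) (c i j)) (cong (λ e → χ B j * (χ A i * e)) (c-sym i j))) ⟩
  sum (λ j → sum (λ i → χ B j * (χ A i * c j i)))   ≡⟨ sum-cong-≗ (λ j → *-distribˡ-sum (χ B j) λ i → χ A i * c j i) ⟨
  sum (λ j → χ B j * sum (λ i → χ A i * c j i))     ∎
  where
  open ≡-Reasoning
  swap : ∀ a b c → a * (b * c) ≡ b * (a * c)
  swap = solve-∀

rect-remove : ∀ {p q} (c : Matrix p q) A (B : Subset q) j → lookup B j ≡ true →
  rect c A (B [ j ]≔ false) + weight A (λ i → c i j) ≡ rect c A B
rect-remove c A B j j∈B = trans (sym (weight-+ A (λ i → weight (B [ j ]≔ false) (c i)) (λ i → c i j)))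
  (weight-cong A λ i → weight-remove B j (c i) j∈B)

-- Since `R ≤ K * α`, the sum `m * α + R` is at most `α * (β + γ)`, and `α ≤ m` replaces `α * γ` by
-- `m * γ`.
small-cut : ∀ m K α β γ R → α ≤ m → m + K ≤ β + γ → R ≤ K * α → m * α + m * β + R ≤ α * β + m * (β + γ)
small-cut m K α β γ R α≤m m+K≤N R≤ =
  by (mulʳ γ α≤m ⊕ mulʳ α m+K≤N ⊕ R≤) 0 (solve (α ∷ β ∷ γ ∷ R ∷ m ∷ K ∷ []))

-- Adding a block of width `v` to `B` raises the left side by `m * v + S`, at most `(m + 1) * v`,
-- and the right side by `α * v`.
drop-cut : ∀ m α β v N R S → m < α → m * α + m * β + R ≤ α * β + m * N → S ≤ v →
  m * α + m * (β + v) + (R + S) ≤ α * (β + v) + m * N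
drop-cut m α β v N R S m<α q S≤v = by (mulʳ v m<α ⊕ q ⊕ S≤v) 0 (solve (α ∷ β ∷ v ∷ N ∷ R ∷ S ∷ m ∷ []))

-- U is the block matrix of the cells used by the rows other than the m longest ones.
module Cuts {n} (w : Fin n → ℕ) (U : Matrix n n) (U-sym : ∀ i j → U i j ≡ U j i) (m K : ℕ)
  (rows≤ : ∀ i → sum (U i) ≤ K * w i) (m+K≤ : m + K ≤ sum w) where

  -- The cut condition for supplies and demands `m * w` and the capacity left over by `U`, with `U`
  -- moved to the left so that no subtraction occurs; `Q⇒cut` translates it back.
  Q : Subset n → Subset n → Set
  Q A B = m * weight A w + m * weight B w + rect U A B ≤ weight A w * weight B w + m * sum w

  Q-sym : ∀ {A B} → Q A B → Q B A
  Q-sym {A} {B} q = subst₂ _≤_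
    (cong₂ _+_ (+-comm (m * weight A w) _) (rect-symmetric U U-sym A B))
    (cong (_+ m * sum w) (*-comm (weight A w) _)) q

  rect-≤ : ∀ A B → rect U A B ≤ K * weight A w
  rect-≤ A B = ≤-trans (sum-mono λ i → *-monoʳ-≤ (χ A i) (≤-trans (weight≤sum B (U i)) (rows≤ i)))
    (≤-reflexive (weight-scale A K w))

  small : ∀ A B → weight A w ≤ m → Q A B
  small A B α≤m = subst (λ N → m * weight A w + m * weight B w + rect U A B ≤ weight A w * weight B w + m * N) N≡
    (small-cut m K (weight A w) (weight B w) (sum w ∸ weight B w) (rect U A B) α≤m
      (≤-trans m+K≤ (≤-reflexive (sym N≡))) (rect-≤ A B))
    where
    N≡ : weight B w + (sum w ∸ weight B w) ≡ sum w
    N≡ = m+[n∸m]≡n (weight≤sum B w)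

  drop : ∀ A B j → sum (U j) ≤ w j → m < weight A w → Q A (B [ j ]≔ false) → lookup B j ≡ true → Q A B
  drop A B j Uj≤ m<α q j∈B = subst₂ (λ β R → m * weight A w + m * β + R ≤ weight A w * β + m * sum w)
    (weight-remove B j w j∈B) (rect-remove U A B j j∈B)
    (drop-cut m (weight A w) (weight (B [ j ]≔ false) w) (w j) (sum w) (rect U A (B [ j ]≔ false)) (weight A λ i → U i j) m<α q
      (≤-trans (weight≤sum A λ i → U i j) (≤-trans (≤-reflexive (sum-cong-≗ λ i → U-sym i j)) Uj≤)))

  capacity : Matrix n n
  capacity i j = w i * w j ∸ U i j

  Q⇒cut : (∀ i j → U i j ≤ w i * w j) → (∀ A B → Q A B) →
    ∀ A B → weight A (λ i → m * w i) + weight B (λ i → m * w i) ≤ rect capacity A B + sum (λ i → m * w i)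
  Q⇒cut U≤ q A B = +-cancelʳ-≤ (rect U A B) _ _ (begin
    weight A (λ i → m * w i) + weight B (λ i → m * w i) + rect U A B
      ≡⟨ cong (_+ rect U A B) (cong₂ _+_ (weight-scale A m w) (weight-scale B m w)) ⟩
    m * weight A w + m * weight B w + rect U A B
      ≤⟨ q A B ⟩
    weight A w * weight B w + m * sum w
      ≡⟨ cong₂ _+_ (rect-product w w A B) (sym (*-distribˡ-sum m w)) ⟨
    rect (λ i j → w i * w j) A B + sum (λ i → m * w i)
      ≡⟨ cong (_+ sum (λ i → m * w i)) (weight-cong A λ i → weight-cong B λ j → m∸n+n≡m (U≤ i j)) ⟨
    rect (λ i j → capacity i j + U i j) A B + sum (λ i → m * w i)
      ≡⟨ cong (_+ sum (λ i → m * w i)) (rect-+ capacity U A B) ⟩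
    rect capacity A B + rect U A B + sum (λ i → m * w i)
      ≡⟨ swapʳ (rect capacity A B) _ _ ⟩
    rect capacity A B + sum (λ i → m * w i) + rect U A B ∎)
    where
    open ≤-Reasoning
    swapʳ : ∀ a b c → (a + b) + c ≡ (a + c) + b
    swapʳ = solve-∀

data IsBit : ℕ → Set where
  bit₀ : IsBit 0
  bit₁ : IsBit 1

χ-bit : ∀ b → IsBit ⟦ b ⟧
χ-bit false = bit₀
χ-bit true  = bit₁

sum₂ : ∀ a b → a + (b + 0) ≡ a + b
sum₂ = solve-∀

sum₃ : ∀ a b c → a + (b + (c + 0)) ≡ a + b + c
sum₃ = solve-∀

unit-multiple : ∀ v → v ≡ (v + 0) * 1
unit-multiple = solve-∀

swap-multiple : ∀ r v → r * v ≡ (v + 0) * r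
swap-multiple = solve-∀

-- The blocks of columns and symbols are numbered from the left, with widths d, c - d, b - c, a - b;
-- the groups of rows are numbered from the top, with multiplicities m, 1, r, 1.
module Assembly {x y z u r m puu puz puy pzz pzy pyy quu quz qzz : ℕ}
  (plan : IsPlan x y z u r m puu puz puy pzz pzy pyy quu quz qzz) (rows≤ : m + (2 + r) ≤ u + (z + (y + (x + 0)))) where
  open IsPlan plan

  w : Fin 4 → ℕ
  w = lookup (u ∷ᵛ z ∷ᵛ y ∷ᵛ x ∷ᵛ []ᵛ)

  mults : Fin 4 → ℕ
  mults = lookup (m ∷ᵛ 1 ∷ᵛ r ∷ᵛ 1 ∷ᵛ []ᵛ)

  -- A staircase: the rows of group `k` extend over the first 4 - k blocks.
  meets : Fin 4 → Fin 4 → Bool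
  meets k a = does (toℕ k + toℕ a <? 4)

  symmetric : ℕ → ℕ → ℕ → ℕ → ℕ → ℕ → Matrix 4 4
  symmetric e₀₀ e₀₁ e₀₂ e₁₁ e₁₂ e₂₂ i j = lookup (lookup
    ((e₀₀ ∷ᵛ e₀₁ ∷ᵛ e₀₂ ∷ᵛ 0 ∷ᵛ []ᵛ) ∷ᵛ
     (e₀₁ ∷ᵛ e₁₁ ∷ᵛ e₁₂ ∷ᵛ 0 ∷ᵛ []ᵛ) ∷ᵛ
     (e₀₂ ∷ᵛ e₁₂ ∷ᵛ e₂₂ ∷ᵛ 0 ∷ᵛ []ᵛ) ∷ᵛ
     (0   ∷ᵛ 0   ∷ᵛ 0   ∷ᵛ 0 ∷ᵛ []ᵛ) ∷ᵛ []ᵛ) i) j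

  symmetric-sym : ∀ {a b c d e f} i j → symmetric a b c d e f i j ≡ symmetric a b c d e f j i
  symmetric-sym 0F 0F = refl
  symmetric-sym 0F 1F = refl
  symmetric-sym 0F 2F = refl
  symmetric-sym 0F 3F = refl
  symmetric-sym 1F 0F = refl
  symmetric-sym 1F 1F = refl
  symmetric-sym 1F 2F = refl
  symmetric-sym 1F 3F = refl
  symmetric-sym 2F 0F = refl
  symmetric-sym 2F 1F = refl
  symmetric-sym 2F 2F = refl
  symmetric-sym 2F 3F = refl
  symmetric-sym 3F 0F = refl
  symmetric-sym 3F 1F = refl
  symmetric-sym 3F 2F = refl
  symmetric-sym 3F 3F = refl

  Xb Xc Xd U : Matrix 4 4
  Xb = symmetric puu puz puy pzz pzy pyy
  Xc = symmetric quu quz 0 qzz 0 0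
  Xd = symmetric u 0 0 0 0 0
  U = symmetric (puu + quu + u) (puz + quz) puy (pzz + qzz) pzy pyy

  U-sum : ∀ i j → Xb i j + (Xc i j + (Xd i j + 0)) ≡ U i j
  U-sum 0F 0F = sum₃ puu quu u
  U-sum 0F 1F = sum₂ puz quz
  U-sum 0F 2F = +-identityʳ puy
  U-sum 0F 3F = refl
  U-sum 1F 0F = sum₂ puz quz
  U-sum 1F 1F = sum₂ pzz qzz
  U-sum 1F 2F = +-identityʳ pzy
  U-sum 1F 3F = refl
  U-sum 2F 0F = +-identityʳ puy
  U-sum 2F 1F = +-identityʳ pzy
  U-sum 2F 2F = +-identityʳ pyy
  U-sum 2F 3F = refl
  U-sum 3F 0F = refl
  U-sum 3F 1F = refl
  U-sum 3F 2F = refl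
  U-sum 3F 3F = refl

  row-u : puu + quu + u + (puz + quz + (puy + 0)) ≡ (2 + r) * u
  row-u = trans (regroup puu quu u puz quz puy) (trans (cong₂ (λ a b → a + b + u) p-u q-u) (total r u))
    where
    regroup : ∀ a b c d e f → a + b + c + (d + e + (f + 0)) ≡ (a + d + f) + (b + e) + c
    regroup = solve-∀
    total : ∀ r u → u + r * u + u ≡ (2 + r) * u
    total = solve-∀

  row-z : puz + quz + (pzz + qzz + (pzy + 0)) ≡ (1 + r) * z
  row-z = trans (regroup puz quz pzz qzz pzy) (cong₂ _+_ p-z q-z)
    where
    regroup : ∀ a b c d e → a + b + (c + d + (e + 0)) ≡ (a + c + e) + (b + d)
    regroup = solve-∀

  row-y : puy + (pzy + (pyy + 0)) ≡ y
  row-y = trans (sum₃ puy pzy pyy) p-y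

  U-rows≤ : ∀ i → sum (U i) ≤ (2 + r) * w i
  U-rows≤ 0F = ≤-reflexive row-u
  U-rows≤ 1F = ≤-trans (≤-reflexive row-z) (m≤n+m ((1 + r) * z) z)
  U-rows≤ 2F = ≤-trans (≤-reflexive row-y) (m≤m+n y ((1 + r) * y))
  U-rows≤ 3F = z≤n

  puy≤ : puy ≤ u * y
  puy≤ = ≤-* {puy} {u} {y} (by (eq-≤ p-u) (puu + puz) (solve (puu ∷ puz ∷ puy ∷ u ∷ []))) (by (eq-≤ p-y) (pzy + pyy) (solve (pzy ∷ pyy ∷ puy ∷ y ∷ [])))

  pzy≤ : pzy ≤ z * y
  pzy≤ = ≤-* {pzy} {z} {y} (by (eq-≤ p-z) (puz + pzz) (solve (puz ∷ pzz ∷ pzy ∷ z ∷ []))) (by (eq-≤ p-y) (puy + pyy) (solve (pzy ∷ pyy ∷ puy ∷ y ∷ [])))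

  pyy≤y : pyy ≤ y
  pyy≤y = by (eq-≤ p-y) (puy + pzy) (solve (pzy ∷ pyy ∷ puy ∷ y ∷ []))

  U≤ : ∀ i j → U i j ≤ w i * w j
  U≤ 0F 0F = cap-uu
  U≤ 0F 1F = cap-uz
  U≤ 0F 2F = puy≤
  U≤ 0F 3F = z≤n
  U≤ 1F 0F = ≤-trans cap-uz (≤-reflexive (*-comm u z))
  U≤ 1F 1F = cap-zz
  U≤ 1F 2F = pzy≤
  U≤ 1F 3F = z≤n
  U≤ 2F 0F = ≤-trans puy≤ (≤-reflexive (*-comm u y))
  U≤ 2F 1F = ≤-trans pzy≤ (≤-reflexive (*-comm z y))
  U≤ 2F 2F = ≤-* pyy≤y pyy≤y
  U≤ 2F 3F = z≤n
  U≤ 3F 0F = z≤n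
  U≤ 3F 1F = z≤n
  U≤ 3F 2F = z≤n
  U≤ 3F 3F = z≤n

  open Cuts w U symmetric-sym m (2 + r) U-rows≤ rows≤

  -- The nine nonempty cuts within the blocks u and z. For one block against the other `cap-uz`
  -- suffices, as m (u + z) is at most m times the total width. If one side contains both blocks,
  -- the margins eliminate the counts q.
  core-bits : ∀ {e₀ e₁ f₀ f₁} → IsBit e₀ → IsBit e₁ → IsBit f₀ → IsBit f₁ → m < e₀ * u + e₁ * z → m < f₀ * u + f₁ * z →
    m * (e₀ * u + e₁ * z) + m * (f₀ * u + f₁ * z)
      + (e₀ * (f₀ * (puu + quu + u) + f₁ * (puz + quz)) + e₁ * (f₀ * (puz + quz) + f₁ * (pzz + qzz)))
    ≤ (e₀ * u + e₁ * z) * (f₀ * u + f₁ * z) + m * (u + (z + (y + (x + 0))))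
  core-bits bit₀ bit₀ _ _ () _
  core-bits bit₀ bit₁ bit₀ bit₀ _ ()
  core-bits bit₁ bit₀ bit₀ bit₀ _ ()
  core-bits bit₁ bit₁ bit₀ bit₀ _ ()
  core-bits bit₁ bit₀ bit₁ bit₀ m<α _ =
    by (cut-u-u (subst (m <_) (trans (+-identityʳ (u + 0)) (+-identityʳ u)) m<α)) 0 (solve (puu ∷ quu ∷ puz ∷ quz ∷ pzz ∷ qzz ∷ m ∷ u ∷ x ∷ y ∷ z ∷ []))
  core-bits bit₁ bit₀ bit₀ bit₁ _ _ =
    by cap-uz (m * (y + x)) (solve (puu ∷ quu ∷ puz ∷ quz ∷ pzz ∷ qzz ∷ m ∷ u ∷ x ∷ y ∷ z ∷ []))
  core-bits bit₁ bit₀ bit₁ bit₁ _ _ =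
    by (cut-u-uz ⊕ eq-≤ p-u ⊕ eq-≤ q-u) 0 (solve (puu ∷ quu ∷ puz ∷ quz ∷ pzz ∷ qzz ∷ puy ∷ m ∷ r ∷ u ∷ x ∷ y ∷ z ∷ []))
  core-bits bit₀ bit₁ bit₁ bit₀ _ _ =
    by cap-uz (m * (y + x)) (solve (puu ∷ quu ∷ puz ∷ quz ∷ pzz ∷ qzz ∷ m ∷ u ∷ x ∷ y ∷ z ∷ []))
  core-bits bit₀ bit₁ bit₀ bit₁ m<α _ =
    by (cut-z-z m<α′) 0 (solve (puu ∷ quu ∷ puz ∷ quz ∷ pzz ∷ qzz ∷ m ∷ u ∷ x ∷ y ∷ z ∷ []))
    where
    m<α′ : m < z
    m<α′ = subst (m <_) (+-identityʳ z) m<α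
  core-bits bit₀ bit₁ bit₁ bit₁ _ _ =
    by (cut-z-uz ⊕ eq-≤ p-z ⊕ eq-≤ q-z) 0 (solve (puu ∷ quu ∷ puz ∷ quz ∷ pzz ∷ qzz ∷ pzy ∷ m ∷ r ∷ u ∷ x ∷ y ∷ z ∷ []))
  core-bits bit₁ bit₁ bit₁ bit₀ _ _ =
    by (cut-u-uz ⊕ eq-≤ p-u ⊕ eq-≤ q-u) 0 (solve (puu ∷ quu ∷ puz ∷ quz ∷ pzz ∷ qzz ∷ puy ∷ m ∷ r ∷ u ∷ x ∷ y ∷ z ∷ []))
  core-bits bit₁ bit₁ bit₀ bit₁ _ _ =
    by (cut-z-uz ⊕ eq-≤ p-z ⊕ eq-≤ q-z) 0 (solve (puu ∷ quu ∷ puz ∷ quz ∷ pzz ∷ qzz ∷ pzy ∷ m ∷ r ∷ u ∷ x ∷ y ∷ z ∷ []))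
  core-bits bit₁ bit₁ bit₁ bit₁ _ _ =
    by (cut-uz-uz ⊕ eq-≤ p-u ⊕ eq-≤ q-u ⊕ eq-≤ p-z ⊕ eq-≤ q-z) 0
      (solve (puu ∷ quu ∷ puz ∷ quz ∷ pzz ∷ qzz ∷ puy ∷ pzy ∷ m ∷ r ∷ u ∷ x ∷ y ∷ z ∷ []))

  Core : Subset 4 → Set
  Core A = ∃ λ a₀ → ∃ λ a₁ → A ≡ a₀ ∷ᵛ a₁ ∷ᵛ false ∷ᵛ false ∷ᵛ []ᵛ

  core : ∀ {A B} → Core A → Core B → Q A B
  core {A} {B} (a₀ , a₁ , refl) (b₀ , b₁ , refl) with weight A w ≤? m | weight B w ≤? m
  ... | yes α≤m | _       = small A B α≤m
  ... | no _    | yes β≤m = Q-sym {B} {A} (small B A β≤m)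
  ... | no α≰m  | no β≰m  = subst₂ _≤_ (cong₂ _+_ (cong₂ _+_ (cong (m *_) (sym α≡)) (cong (m *_) (sym β≡))) rect≡)
      (cong (_+ m * sum w) (cong₂ _*_ (sym α≡) (sym β≡)))
      (core-bits (χ-bit a₀) (χ-bit a₁) (χ-bit b₀) (χ-bit b₁) (subst (m <_) α≡ (≰⇒> α≰m)) (subst (m <_) β≡ (≰⇒> β≰m)))
    where
    weight-core : ∀ e₀ e₁ f₀ f₁ → e₀ * f₀ + (e₁ * f₁ + 0) ≡ e₀ * f₀ + e₁ * f₁
    weight-core = solve-∀
    α≡ : weight A w ≡ ⟦ a₀ ⟧ * u + ⟦ a₁ ⟧ * z
    α≡ = weight-core ⟦ a₀ ⟧ ⟦ a₁ ⟧ u z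
    β≡ : weight B w ≡ ⟦ b₀ ⟧ * u + ⟦ b₁ ⟧ * z
    β≡ = weight-core ⟦ b₀ ⟧ ⟦ b₁ ⟧ u z
    rect-core : ∀ e₀ e₁ f₀ f₁ s t v → e₀ * (f₀ * s + f₁ * t) + e₁ * (f₀ * t + f₁ * v)
      ≡ e₀ * (f₀ * s + (f₁ * t + 0)) + (e₁ * (f₀ * t + (f₁ * v + 0)) + 0)
    rect-core = solve-∀
    rect≡ : ⟦ a₀ ⟧ * (⟦ b₀ ⟧ * (puu + quu + u) + ⟦ b₁ ⟧ * (puz + quz)) + ⟦ a₁ ⟧ * (⟦ b₀ ⟧ * (puz + quz) + ⟦ b₁ ⟧ * (pzz + qzz))
      ≡ rect U A B
    rect≡ = rect-core ⟦ a₀ ⟧ ⟦ a₁ ⟧ ⟦ b₀ ⟧ ⟦ b₁ ⟧ (puu + quu + u) (puz + quz) (pzz + qzz)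

  reduce : ∀ A → (∀ {B} → Core B → Q A B) → ∀ B → Q A B
  reduce A q B with weight A w ≤? m
  ... | yes α≤m = small A B α≤m
  ... | no α≰m = strip B
    where
    m<α : m < weight A w
    m<α = ≰⇒> α≰m
    strip-y : ∀ b₀ b₁ b₂ → Q A (b₀ ∷ᵛ b₁ ∷ᵛ b₂ ∷ᵛ false ∷ᵛ []ᵛ)
    strip-y b₀ b₁ false = q (b₀ , b₁ , refl)
    -- The only short row that reaches the block of width b - c is the single row b, so the block is
    -- used exactly `y` times; no short row reaches the block of width a - b.
    strip-y b₀ b₁ true  = drop A (b₀ ∷ᵛ b₁ ∷ᵛ true ∷ᵛ false ∷ᵛ []ᵛ) 2F (≤-reflexive row-y) m<α (q (b₀ , b₁ , refl)) refl
    strip : ∀ B → Q A B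
    strip (b₀ ∷ᵛ b₁ ∷ᵛ b₂ ∷ᵛ false ∷ᵛ []ᵛ) = strip-y b₀ b₁ b₂
    strip (b₀ ∷ᵛ b₁ ∷ᵛ b₂ ∷ᵛ true ∷ᵛ []ᵛ)  = drop A (b₀ ∷ᵛ b₁ ∷ᵛ b₂ ∷ᵛ true ∷ᵛ []ᵛ) 3F z≤n m<α (strip-y b₀ b₁ b₂) refl

  -- Only columns can be stripped from a cut, so `Q-sym` exchanges the two sides to strip the other
  -- one.
  all-cuts : ∀ A B → Q A B
  all-cuts A B = Q-sym {B} {A} (reduce B (λ {A′} coreA′ → Q-sym {A′} {B} (reduce A′ (core coreA′) B)) A)

  flow : Transport.Flow (λ a → m * w a) (λ a → m * w a) refl capacity
  flow = Transport.transport (λ a → m * w a) (λ a → m * w a) refl capacity (Q⇒cut U≤ all-cuts)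

  Xa : Matrix 4 4
  Xa = proj₁ flow

  X : Fin 4 → Matrix 4 4
  X 0F = Xa
  X 1F = Xb
  X 2F = Xc
  X 3F = Xd

  X-capacity : ∀ a b → sum (λ k → X k a b) ≤ w a * w b
  X-capacity a b = ≤-trans (≤-reflexive (cong (Xa a b +_) (U-sum a b)))
    (≤-trans (+-monoˡ-≤ (U a b) (proj₁ (proj₂ flow) a b)) (≤-reflexive (m∸n+n≡m (U≤ a b))))

  X-rows : ∀ k a → sum (X k a) ≡ ⟦ meets k a ⟧ * w a * mults k
  X-rows 0F a = trans (proj₁ (proj₂ (proj₂ flow)) a) (trans (*-comm m (w a)) (cong (_* m) (full a)))
    where
    full : ∀ a → w a ≡ ⟦ meets 0F a ⟧ * w a
    full 0F = sym (*-identityˡ u)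
    full 1F = sym (*-identityˡ z)
    full 2F = sym (*-identityˡ y)
    full 3F = sym (*-identityˡ x)
  X-rows 1F 0F = trans (sum₃ puu puz puy) (trans p-u (unit-multiple u))
  X-rows 1F 1F = trans (sum₃ puz pzz pzy) (trans p-z (unit-multiple z))
  X-rows 1F 2F = trans row-y (unit-multiple y)
  X-rows 1F 3F = refl
  X-rows 2F 0F = trans (sum₂ quu quz) (trans q-u (swap-multiple r u))
  X-rows 2F 1F = trans (sum₂ quz qzz) (trans q-z (swap-multiple r z))
  X-rows 2F 2F = refl
  X-rows 2F 3F = refl
  X-rows 3F 0F = sym (*-identityʳ (u + 0))
  X-rows 3F 1F = refl
  X-rows 3F 2F = refl
  X-rows 3F 3F = refl

  X-columns : ∀ k b → sum (λ a → X k a b) ≡ ⟦ meets k b ⟧ * w b * mults k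
  X-columns 0F b = trans (proj₂ (proj₂ (proj₂ flow)) b) (trans (sym (proj₁ (proj₂ (proj₂ flow)) b)) (X-rows 0F b))
  X-columns 1F b = trans (sum-cong-≗ λ a → symmetric-sym {puu} {puz} {puy} {pzz} {pzy} {pyy} a b) (X-rows 1F b)
  X-columns 2F b = trans (sum-cong-≗ λ a → symmetric-sym {quu} {quz} {0} {qzz} {0} {0} a b) (X-rows 2F b)
  X-columns 3F b = trans (sum-cong-≗ λ a → symmetric-sym {u} {0} {0} {0} {0} {0} a b) (X-rows 3F b)

-- Inequalities from wideness

sum-take-+ : ∀ j L (f g : ℕ → ℕ) →
  sumˡ (take j (applyUpTo (λ i → f i + g i) L)) ≡ sumˡ (take j (applyUpTo f L)) + sumˡ (take j (applyUpTo g L))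
sum-take-+ zero    L       f g = refl
sum-take-+ (suc j) zero    f g = refl
sum-take-+ (suc j) (suc L) f g =
  trans (cong (f 0 + g 0 +_) (sum-take-+ j L (λ i → f (suc i)) (λ i → g (suc i)))) (swap (f 0) (g 0) _ _)
  where
  swap : ∀ a b c d → (a + b) + (c + d) ≡ (a + c) + (b + d)
  swap = solve-∀

sum-take-cong : ∀ j L {f g : ℕ → ℕ} → (∀ i → f i ≡ g i) → sumˡ (take j (applyUpTo f L)) ≡ sumˡ (take j (applyUpTo g L))
sum-take-cong zero    L       f≗g = refl
sum-take-cong (suc j) zero    f≗g = refl
sum-take-cong (suc j) (suc L) f≗g = cong₂ _+_ (f≗g 0) (sum-take-cong j L λ i → f≗g (suc i))

⊓≤sum-take : ∀ j v L → v ≤ L → j ⊓ v ≤ sumˡ (take j (applyUpTo (λ i → ⟦ i <ᵇ v ⟧) L))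
⊓≤sum-take zero    v       L       _         = z≤n
⊓≤sum-take (suc j) zero    L       _         = z≤n
⊓≤sum-take (suc j) (suc v) (suc L) (s≤s v≤L) = s≤s (⊓≤sum-take j v L v≤L)

-- Both sides count the cells in the first `j` columns of the diagram, by rows on the left and by
-- columns on the right.
sum-⊓≤psum-conj : ∀ j {μ} → All (_≤ largest μ) μ → sumˡ (map (j ⊓_) μ) ≤ psum j (conj μ)
sum-⊓≤psum-conj j {μ} μ≤ = ≤-trans (bound μ (largest μ) μ≤)
  (≤-reflexive (cong (λ xs → sumˡ (take j xs)) (sym (Listₚ.map-upTo (λ i → length (filter (suc i ≤?_) μ)) (largest μ)))))
  where
  bound : ∀ μ L → All (_≤ L) μ → sumˡ (map (j ⊓_) μ) ≤ sumˡ (take j (applyUpTo (λ i → length (filter (suc i ≤?_) μ)) L))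
  bound []      L []ᵃ          = z≤n
  bound (v ∷ μ) L (v≤L ∷ᵃ μ≤L) = begin
    j ⊓ v + sumˡ (map (j ⊓_) μ)
      ≤⟨ +-mono-≤ (⊓≤sum-take j v L v≤L) (bound μ L μ≤L) ⟩
    sumˡ (take j (applyUpTo (λ i → ⟦ i <ᵇ v ⟧) L)) + sumˡ (take j (applyUpTo (λ i → length (filter (suc i ≤?_) μ)) L))
      ≡⟨ sum-take-+ j L (λ i → ⟦ i <ᵇ v ⟧) (λ i → length (filter (suc i ≤?_) μ)) ⟨
    sumˡ (take j (applyUpTo (λ i → ⟦ i <ᵇ v ⟧ + length (filter (suc i ≤?_) μ)) L))
      ≡⟨ sum-take-cong j L (λ i → length-filter-∷ (suc i ≤?_) v μ) ⟨
    sumˡ (take j (applyUpTo (λ i → length (filter (suc i ≤?_) (v ∷ μ))) L)) ∎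
    where open ≤-Reasoning

sum-map-replicate : ∀ (f : ℕ → ℕ) n v xs → sumˡ (map f (replicate n v ++ xs)) ≡ n * f v + sumˡ (map f xs)
sum-map-replicate f zero    v xs = refl
sum-map-replicate f (suc n) v xs = trans (cong (f v +_) (sum-map-replicate f n v xs)) (sym (+-assoc (f v) _ _))

psum-replicate : ∀ j n v xs → psum j (replicate n v ++ xs) ≡ (j ⊓ n) * v + psum (j ∸ n) xs
psum-replicate zero    zero    v xs = refl
psum-replicate zero    (suc n) v xs = refl
psum-replicate (suc j) zero    v xs = refl
psum-replicate (suc j) (suc n) v xs = trans (cong (v +_) (psum-replicate j n v xs)) (sym (+-assoc v _ _))

-- The partition a^m b^p c^r d with a = u + z + y + x, b = u + z + y, c = u + z and d = u.
part : (x y z u m p r : ℕ) → List ℕ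
part x y z u m p r = replicate m (u + z + y + x) ++ replicate p (u + z + y) ++ replicate r (u + z) ++ u ∷ []

-- Each `I` is the number of the first `j` rows that reach a given block. Keeping both upper bounds
-- of these minima lets one dominance inequality yield several linear ones.
record Prefix (x y z u m p r j : ℕ) : Set where
  field
    I₁ I₂ I₃ I₄ : ℕ
    I₁≤ : I₁ ≤ m
    I₁≤j : I₁ ≤ j
    I₂≤ : I₂ ≤ m + p
    I₂≤j : I₂ ≤ j
    I₃≤ : I₃ ≤ m + p + r
    I₃≤j : I₃ ≤ j
    I₄≤j : I₄ ≤ j
    psum≡ : psum j (part x y z u m p r) ≡ x * I₁ + y * I₂ + z * I₃ + u * I₄

prefix : ∀ x y z u m p r j → Prefix x y z u m p r j
prefix x y z u m p r j = record
  { I₁ = i₁ ; I₂ = i₁ + i₂ ; I₃ = i₁ + i₂ + i₃ ; I₄ = i₁ + i₂ + i₃ + i₄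
  ; I₁≤ = m⊓n≤n j m
  ; I₁≤j = m⊓n≤m j m
  ; I₂≤ = +-mono-≤ (m⊓n≤n j m) (m⊓n≤n (j ∸ m) p)
  ; I₂≤j = ≤-trans (m≤m+n _ i₃) I₃≤j
  ; I₃≤ = +-mono-≤ (+-mono-≤ (m⊓n≤n j m) (m⊓n≤n (j ∸ m) p)) (m⊓n≤n (j ∸ m ∸ p) r)
  ; I₃≤j = I₃≤j
  ; I₄≤j = ≤-trans (+-monoʳ-≤ (i₁ + i₂ + i₃) (m⊓n≤m (j ∸ m ∸ p ∸ r) 1)) (≤-reflexive used)
  ; psum≡ = begin
      psum j (part x y z u m p r)
        ≡⟨ psum-replicate j m (u + z + y + x) _ ⟩
      i₁ * (u + z + y + x) + psum (j ∸ m) (replicate p (u + z + y) ++ replicate r (u + z) ++ u ∷ [])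
        ≡⟨ cong (i₁ * (u + z + y + x) +_) (psum-replicate (j ∸ m) p (u + z + y) _) ⟩
      i₁ * (u + z + y + x) + (i₂ * (u + z + y) + psum (j ∸ m ∸ p) (replicate r (u + z) ++ u ∷ []))
        ≡⟨ cong (λ v → i₁ * (u + z + y + x) + (i₂ * (u + z + y) + v)) (psum-replicate (j ∸ m ∸ p) r (u + z) _) ⟩
      i₁ * (u + z + y + x) + (i₂ * (u + z + y) + (i₃ * (u + z) + psum (j ∸ m ∸ p ∸ r) (u ∷ [])))
        ≡⟨ cong (λ v → i₁ * (u + z + y + x) + (i₂ * (u + z + y) + (i₃ * (u + z) + v))) (psum-replicate (j ∸ m ∸ p ∸ r) 1 u []) ⟩
      i₁ * (u + z + y + x) + (i₂ * (u + z + y) + (i₃ * (u + z) + (i₄ * u + psum (j ∸ m ∸ p ∸ r ∸ 1) [])))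
        ≡⟨ cong (λ v → i₁ * (u + z + y + x) + (i₂ * (u + z + y) + (i₃ * (u + z) + (i₄ * u + v)))) (psum-[] (j ∸ m ∸ p ∸ r ∸ 1)) ⟩
      i₁ * (u + z + y + x) + (i₂ * (u + z + y) + (i₃ * (u + z) + (i₄ * u + 0)))
        ≡⟨ collect i₁ i₂ i₃ i₄ x y z u ⟩
      x * i₁ + y * (i₁ + i₂) + z * (i₁ + i₂ + i₃) + u * (i₁ + i₂ + i₃ + i₄) ∎ }
  where
  open ≡-Reasoning
  i₁ = j ⊓ m
  i₂ = (j ∸ m) ⊓ p
  i₃ = (j ∸ m ∸ p) ⊓ r
  i₄ = (j ∸ m ∸ p ∸ r) ⊓ 1
  psum-[] : ∀ j → psum j [] ≡ 0
  psum-[] zero    = refl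
  psum-[] (suc j) = refl
  ⊓-∸ : ∀ j n → j ⊓ n + (j ∸ n) ≡ j
  ⊓-∸ j n = trans (cong (_+ (j ∸ n)) (⊓-comm j n)) (m⊓n+n∸m≡n n j)
  used : i₁ + i₂ + i₃ + (j ∸ m ∸ p ∸ r) ≡ j
  used = trans (+-assoc (i₁ + i₂) i₃ _) (trans (cong (i₁ + i₂ +_) (⊓-∸ (j ∸ m ∸ p) r))
    (trans (+-assoc i₁ i₂ _) (trans (cong (i₁ +_) (⊓-∸ (j ∸ m) p)) (⊓-∸ j m))))
  I₃≤j : i₁ + i₂ + i₃ ≤ j
  I₃≤j = ≤-trans (m≤m+n _ (j ∸ m ∸ p ∸ r)) (≤-reflexive used)
  collect : ∀ i₁ i₂ i₃ i₄ x y z u → i₁ * (u + z + y + x) + (i₂ * (u + z + y) + (i₃ * (u + z) + (i₄ * u + 0)))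
    ≡ x * i₁ + y * (i₁ + i₂) + z * (i₁ + i₂ + i₃) + u * (i₁ + i₂ + i₃ + i₄)
  collect = solve-∀

Linked-∷ : ∀ {v xs} → All (_≤ v) xs → Linked _≥_ xs → Linked _≥_ (v ∷ xs)
Linked-∷ []ᵃ       _ = [-]
Linked-∷ (h ∷ᵃ _) l = h ∷ˡ l

All-replicate-++ : ∀ {P : ℕ → Set} n {v xs} → P v → All P xs → All P (replicate n v ++ xs)
All-replicate-++ zero    pv pxs = pxs
All-replicate-++ (suc n) pv pxs = pv ∷ᵃ All-replicate-++ n pv pxs

Linked-replicate-++ : ∀ n {v xs} → All (_≤ v) xs → Linked _≥_ xs → Linked _≥_ (replicate n v ++ xs)
Linked-replicate-++ zero    xs≤v l = l
Linked-replicate-++ (suc n) xs≤v l = Linked-∷ (All-replicate-++ n ≤-refl xs≤v) (Linked-replicate-++ n xs≤v l)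

≤-all⁺ : ∀ {v w xs} → v ≤ w → All (_≤ v) xs → All (_≤ w) xs
≤-all⁺ v≤w = All.map λ h → ≤-trans h v≤w

largest-bound : ∀ {μ} → Linked _≥_ μ → All (_≤ largest μ) μ
largest-bound []ˡ      = []ᵃ
largest-bound [-]      = ≤-refl ∷ᵃ []ᵃ
largest-bound (h ∷ˡ l) = ≤-refl ∷ᵃ ≤-all⁺ h (largest-bound l)

part-partition : ∀ x y z u m p r → 0 < u → IsPartition (part x y z u m p r)
part-partition x y z u m p r 0<u = sorted , positive
  where
  c≤ : All (_≤ u + z) (replicate r (u + z) ++ u ∷ [])
  c≤ = All-replicate-++ r ≤-refl (m≤m+n u z ∷ᵃ []ᵃ)
  b≤ : All (_≤ u + z + y) (replicate p (u + z + y) ++ replicate r (u + z) ++ u ∷ [])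
  b≤ = All-replicate-++ p ≤-refl (≤-all⁺ (m≤m+n (u + z) y) c≤)
  sorted : Linked _≥_ (part x y z u m p r)
  sorted = Linked-replicate-++ m (≤-all⁺ (m≤m+n (u + z + y) x) b≤)
    (Linked-replicate-++ p (≤-all⁺ (m≤m+n (u + z) y) c≤) (Linked-replicate-++ r (m≤m+n u z ∷ᵃ []ᵃ) [-]))
  0<c : 0 < u + z
  0<c = ≤-trans 0<u (m≤m+n u z)
  0<b : 0 < u + z + y
  0<b = ≤-trans 0<c (m≤m+n (u + z) y)
  positive : All (0 <_) (part x y z u m p r)
  positive = All-replicate-++ m (≤-trans 0<b (m≤m+n (u + z + y) x))
    (All-replicate-++ p 0<b (All-replicate-++ r 0<c (0<u ∷ᵃ []ᵃ)))

mult-++ : ∀ t xs ys → mult t (xs ++ ys) ≡ mult t xs + mult t ys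
mult-++ t xs ys = trans (cong length (Listₚ.filter-++ (t ≟_) xs ys)) (Listₚ.length-++ (filter (t ≟_) xs))

-- For j ≤ c every part except d contributes a full `j` to the conjugate. The functions `g₁`, ...,
-- `g₄` select, block by block, which bound on the number of rows enters the right side.
dominance-ineq : ∀ x y z u m p r j → 0 < u → Dominates (part x y z u m p r) (conj (part x y z u m p r)) → j ≤ z + u →
  ∀ {g₁ g₂ g₃ g₄} → (∀ {I} → I ≤ m → I ≤ j → I ≤ g₁) → (∀ {I} → I ≤ m + p → I ≤ j → I ≤ g₂) →
  (∀ {I} → I ≤ m + p + r → I ≤ j → I ≤ g₃) → (∀ {I} → I ≤ j → I ≤ g₄) →
  (m + p + r) * j + j ⊓ u ≤ x * g₁ + y * g₂ + z * g₃ + u * g₄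
dominance-ineq x y z u m p r j 0<u dom j≤c g₁ g₂ g₃ g₄ = begin
  (m + p + r) * j + j ⊓ u
    ≡⟨ expand m p r j (j ⊓ u) ⟩
  m * j + (p * j + (r * j + (1 * (j ⊓ u) + 0)))
    ≡⟨ cong₂ _+_ (cong (m *_) (m≤n⇒m⊓n≡m j≤a)) (cong₂ _+_ (cong (p *_) (m≤n⇒m⊓n≡m j≤b)) (cong (λ v → r * v + (1 * (j ⊓ u) + 0)) (m≤n⇒m⊓n≡m j≤c′))) ⟨
  m * (j ⊓ (u + z + y + x)) + (p * (j ⊓ (u + z + y)) + (r * (j ⊓ (u + z)) + (1 * (j ⊓ u) + 0)))
    ≡⟨ total ⟨
  sumˡ (map (j ⊓_) (part x y z u m p r))
    ≤⟨ sum-⊓≤psum-conj j (largest-bound (proj₁ (part-partition x y z u m p r 0<u))) ⟩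
  psum j (conj (part x y z u m p r))
    ≤⟨ dom j ⟩
  psum j (part x y z u m p r)
    ≡⟨ psum≡ ⟩
  x * I₁ + y * I₂ + z * I₃ + u * I₄
    ≤⟨ +-mono-≤ (+-mono-≤ (+-mono-≤ (*-monoʳ-≤ x (g₁ I₁≤ I₁≤j)) (*-monoʳ-≤ y (g₂ I₂≤ I₂≤j))) (*-monoʳ-≤ z (g₃ I₃≤ I₃≤j))) (*-monoʳ-≤ u (g₄ I₄≤j)) ⟩
  _ ∎
  where
  open ≤-Reasoning
  open Prefix (prefix x y z u m p r j)
  j≤c′ : j ≤ u + z
  j≤c′ = ≤-trans j≤c (≤-reflexive (+-comm z u))
  j≤b : j ≤ u + z + y
  j≤b = ≤-trans j≤c′ (m≤m+n _ y)
  j≤a : j ≤ u + z + y + x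
  j≤a = ≤-trans j≤b (m≤m+n _ x)
  expand : ∀ m p r j v → (m + p + r) * j + v ≡ m * j + (p * j + (r * j + (1 * v + 0)))
  expand = solve-∀
  total : sumˡ (map (j ⊓_) (part x y z u m p r)) ≡ _
  total = trans (sum-map-replicate (j ⊓_) m (u + z + y + x) _) (cong (m * (j ⊓ (u + z + y + x)) +_)
    (trans (sum-map-replicate (j ⊓_) p (u + z + y) _) (cong (p * (j ⊓ (u + z + y)) +_)
      (trans (sum-map-replicate (j ⊓_) r (u + z) _) (cong (r * (j ⊓ (u + z)) +_) (sum-map-replicate (j ⊓_) 1 u []))))))

module _ (x y z u m r : ℕ) (0<u : 0 < u)
  (with-b : Dominates (part x y z u m 1 r) (conj (part x y z u m 1 r)))
  (sans-b : Dominates (part x y z u m 0 r) (conj (part x y z u m 0 r))) where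

  private
    u≤c : u ≤ z + u
    u≤c = m≤n+m u z
    z≤c : z ≤ z + u
    z≤c = m≤m+n z u
    sans : ∀ {I} → I ≤ m + 0 → I ≤ m
    sans I≤ = ≤-trans I≤ (≤-reflexive (+-identityʳ m))

  wideIneqs : WideIneqs x y z u r m
  wideIneqs = record
    { with-b-at-d  = by (subst (λ v → (m + 1 + r) * u + v ≤ x * m + y * (m + 1) + z * u + u * u) (⊓-idem u)
                         (dominance-ineq x y z u m 1 r u 0<u with-b u≤c (λ h _ → h) (λ h _ → h) (λ _ h → h) (λ h → h))) 0 (solve (x ∷ y ∷ z ∷ u ∷ m ∷ r ∷ []))
    ; with-b-at-d′ = by (subst (λ v → (m + 1 + r) * u + v ≤ x * m + y * (m + 1) + z * (m + 1 + r) + u * u) (⊓-idem u)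
                         (dominance-ineq x y z u m 1 r u 0<u with-b u≤c (λ h _ → h) (λ h _ → h) (λ h _ → h) (λ h → h))) 0 (solve (x ∷ y ∷ z ∷ u ∷ m ∷ r ∷ []))
    ; sans-b-at-d  = by (subst (λ v → (m + 0 + r) * u + v ≤ x * m + y * m + z * u + u * u) (⊓-idem u)
                         (dominance-ineq x y z u m 0 r u 0<u sans-b u≤c (λ h _ → h) (λ h _ → sans h) (λ _ h → h) (λ h → h))) 0 (solve (x ∷ y ∷ z ∷ u ∷ m ∷ r ∷ []))
    ; sans-b-at-d′ = by (subst (λ v → (m + 0 + r) * u + v ≤ x * m + y * m + z * (m + 0 + r) + u * u) (⊓-idem u)
                         (dominance-ineq x y z u m 0 r u 0<u sans-b u≤c (λ h _ → h) (λ h _ → sans h) (λ h _ → h) (λ h → h))) 0 (solve (x ∷ y ∷ z ∷ u ∷ m ∷ r ∷ []))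
    ; with-b-at-z  = generalise (z ⊓ u) (dominance-ineq x y z u m 1 r z 0<u with-b z≤c (λ h _ → h) (λ h _ → h) (λ _ h → h) (λ h → h))
    ; sans-b-at-z  = generalise′ (z ⊓ u) (dominance-ineq x y z u m 0 r z 0<u sans-b z≤c (λ h _ → h) (λ h _ → sans h) (λ _ h → h) (λ h → h))
    ; with-b-at-c  = by (subst (λ v → (m + 1 + r) * (z + u) + v ≤ x * m + y * (m + 1) + z * (z + u) + u * (z + u)) (m≥n⇒m⊓n≡n u≤c)
                         (dominance-ineq x y z u m 1 r (z + u) 0<u with-b ≤-refl (λ h _ → h) (λ h _ → h) (λ _ h → h) (λ h → h))) 0 (solve (x ∷ y ∷ z ∷ u ∷ m ∷ r ∷ []))
    }
    where
    generalise : ∀ v → (m + 1 + r) * z + v ≤ x * m + y * (m + 1) + z * z + u * z →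
      (m + 1 + r) * z + v ≤ m * x + (m + 1) * y + z * z + u * z
    generalise v h = by h 0 (solve (x ∷ y ∷ z ∷ u ∷ m ∷ r ∷ v ∷ []))
    generalise′ : ∀ v → (m + 0 + r) * z + v ≤ x * m + y * m + z * z + u * z →
      (m + r) * z + v ≤ m * x + m * y + z * z + u * z
    generalise′ v h = by h 0 (solve (x ∷ y ∷ z ∷ u ∷ m ∷ r ∷ v ∷ []))

  -- Dominance at j = d with every block count bounded by j: d times the number of rows is at most d
  -- times a, and d cancels.
  rows≤width : m + (2 + r) ≤ u + (z + (y + (x + 0)))
  rows≤width = *-cancelʳ-≤ _ _ u {{>-nonZero 0<u}}
    (by (subst (λ v → (m + 1 + r) * u + v ≤ x * u + y * u + z * u + u * u) (⊓-idem u)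
      (dominance-ineq x y z u m 1 r u 0<u with-b u≤c (λ _ h → h) (λ _ h → h) (λ _ h → h) (λ h → h))) 0 (solve (x ∷ y ∷ z ∷ u ∷ m ∷ r ∷ [])))

-- The partition a^m b c^r d

sum-toℕ-+ : ∀ p q (g : ℕ → ℕ) → sum {p + q} (g ∘ toℕ) ≡ sum {p} (g ∘ toℕ) + sum {q} (λ i → g (p + toℕ i))
sum-toℕ-+ zero    q g = refl
sum-toℕ-+ (suc p) q g = trans (cong (g 0 +_) (sum-toℕ-+ p q (g ∘ suc))) (sym (+-assoc (g 0) _ _))

sum-const : ∀ n {f : Fin n → ℕ} v → (∀ i → f i ≡ v) → sum f ≡ n * v
sum-const zero    v f≡v = refl
sum-const (suc n) v f≡v = cong₂ _+_ (f≡v zero) (sum-const n v (f≡v ∘ suc))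

-- The last block is treated as unbounded.
locate : ∀ {n} → Vec ℕ (suc n) → ℕ → Fin (suc n)
locate (w ∷ᵛ []ᵛ)     i = zero
locate (w ∷ᵛ v ∷ᵛ ws) i = if does (i <? w) then zero else suc (locate (v ∷ᵛ ws) (i ∸ w))

locate-< : ∀ {n} w v (ws : Vec ℕ n) {i} → i < w → locate (w ∷ᵛ v ∷ᵛ ws) i ≡ zero
locate-< w v ws {i} i<w = cong (if_then zero else suc (locate (v ∷ᵛ ws) (i ∸ w))) (dec-true (i <? w) i<w)

locate-≥ : ∀ {n} w v (ws : Vec ℕ n) {i} → ¬ i < w → locate (w ∷ᵛ v ∷ᵛ ws) i ≡ suc (locate (v ∷ᵛ ws) (i ∸ w))
locate-≥ w v ws {i} i≮w = cong (if_then zero else suc (locate (v ∷ᵛ ws) (i ∸ w))) (dec-false (i <? w) i≮w)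

count-locate : ∀ {n} (ws : Vec ℕ (suc n)) b → sum {sumᵛ ws} (λ i → δ b (locate ws (toℕ i))) ≡ lookup ws b
count-locate (w ∷ᵛ []ᵛ) 0F = trans (sum-const (w + 0) 1 λ _ → refl) (trans (*-identityʳ (w + 0)) (+-identityʳ w))
count-locate (w ∷ᵛ v ∷ᵛ ws) b = begin
  sum {w + sumᵛ (v ∷ᵛ ws)} (g ∘ toℕ)
    ≡⟨ sum-toℕ-+ w (sumᵛ (v ∷ᵛ ws)) g ⟩
  sum {w} (g ∘ toℕ) + sum {sumᵛ (v ∷ᵛ ws)} (λ i → g (w + toℕ i))
    ≡⟨ cong₂ _+_ (sum-const w (δ b zero) λ i → cong (δ b) (locate-< w v ws (Finₚ.toℕ<n i)))
         (sum-cong-≗ {sumᵛ (v ∷ᵛ ws)} λ i → cong (δ b) (trans (locate-≥ w v ws (m+n≮m w (toℕ i))) (cong (λ i → suc (locate (v ∷ᵛ ws) i)) (m+n∸m≡n w (toℕ i))))) ⟩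
  w * δ b zero + sum {sumᵛ (v ∷ᵛ ws)} (λ i → δ b (suc (locate (v ∷ᵛ ws) (toℕ i))))
    ≡⟨ by-block b ⟩
  lookup (w ∷ᵛ v ∷ᵛ ws) b ∎
  where
  open ≡-Reasoning
  g : ℕ → ℕ
  g i = δ b (locate (w ∷ᵛ v ∷ᵛ ws) i)
  by-block : ∀ b → w * δ b zero + sum {sumᵛ (v ∷ᵛ ws)} (λ i → δ b (suc (locate (v ∷ᵛ ws) (toℕ i)))) ≡ lookup (w ∷ᵛ v ∷ᵛ ws) b
  by-block zero    = trans (cong₂ _+_ (*-identityʳ w) (sum-zero {sumᵛ (v ∷ᵛ ws)} {λ _ → 0} λ _ → refl)) (+-identityʳ w)
  by-block (suc b) = cong₂ _+_ (*-zeroʳ w)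
    (trans (sum-cong-≗ {sumᵛ (v ∷ᵛ ws)} λ i → δ-suc b (locate (v ∷ᵛ ws) (toℕ i))) (count-locate (v ∷ᵛ ws) b))

rowLen-replicate-< : ∀ n v xs {i} → i < n → rowLen (replicate n v ++ xs) i ≡ v
rowLen-replicate-< (suc n) v xs {zero}  _         = refl
rowLen-replicate-< (suc n) v xs {suc i} (s≤s i<n) = rowLen-replicate-< n v xs i<n

rowLen-replicate-≥ : ∀ n v xs {i} → ¬ i < n → rowLen (replicate n v ++ xs) i ≡ rowLen xs (i ∸ n)
rowLen-replicate-≥ zero    v xs         _   = refl
rowLen-replicate-≥ (suc n) v xs {zero}  i≮n = contradiction (s≤s z≤n) i≮n
rowLen-replicate-≥ (suc n) v xs {suc i} i≮n = rowLen-replicate-≥ n v xs (i≮n ∘ s≤s)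

rowLen≤ : ∀ {N} xs → (∀ i → i < length xs → rowLen xs i ≤ N) → ∀ i → rowLen xs i ≤ N
rowLen≤ xs h i with rowLen xs i in eq
... | zero  = z≤n
... | suc k = subst (_≤ _) eq (h i (rowLen-pos⇒< xs i {0} (subst (0 <_) (sym eq) (s≤s z≤n))))

-- The multiplicity `suc m` ensures that the first row has length a, so that `largest` is the total
-- width of the four blocks.
module Tableau-of-plan {x y z u r m puu puz puy pzz pzy pyy quu quz qzz : ℕ}
  (pl : IsPlan x y z u r (suc m) puu puz puy pzz pzy pyy quu quz qzz) (rows≤ : suc m + (2 + r) ≤ u + (z + (y + (x + 0)))) where

  open Assembly pl rows≤ using (X; X-rows; X-columns; X-capacity; meets)

  lam : List ℕ
  lam = part x y z u (suc m) 1 r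

  widths : Vec ℕ 4
  widths = u ∷ᵛ z ∷ᵛ y ∷ᵛ x ∷ᵛ []ᵛ

  multiplicities : Vec ℕ 4
  multiplicities = suc m ∷ᵛ 1 ∷ᵛ r ∷ᵛ 1 ∷ᵛ []ᵛ

  N : ℕ
  N = sumᵛ widths

  lengths : Fin 4 → ℕ
  lengths = lookup (u + z + y + x ∷ᵛ u + z + y ∷ᵛ u + z ∷ᵛ u ∷ᵛ []ᵛ)

  length-lam : length lam ≡ sumᵛ multiplicities
  length-lam = trans (Listₚ.length-++ (replicate (suc m) (u + z + y + x))) (cong₂ _+_ (Listₚ.length-replicate (suc m))
    (cong suc (trans (Listₚ.length-++ (replicate r (u + z))) (cong (_+ 1) (Listₚ.length-replicate r)))))

  ρ : Fin (length lam) → Fin 4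
  ρ i = locate multiplicities (toℕ i)

  κ : Fin N → Fin 4
  κ c = locate widths (toℕ c)

  count-ρ : ∀ k → count ρ k ≡ lookup multiplicities k
  count-ρ k = trans (cong (λ n → sum {n} λ i → δ k (locate multiplicities (toℕ i))) length-lam) (count-locate multiplicities k)

  count-κ : ∀ a → count κ a ≡ lookup widths a
  count-κ = count-locate widths

  rowLen-lam : ∀ i → i < length lam → rowLen lam i ≡ lengths (locate multiplicities i)
  rowLen-lam i i<M = first (i <? suc m)
    where
    d-row c-rows b-rows : List ℕ
    d-row = u ∷ []
    c-rows = replicate r (u + z) ++ d-row
    b-rows = replicate 1 (u + z + y) ++ c-rows
    i₁ i₂ i₃ : ℕ
    i₁ = i ∸ suc m
    i₂ = i₁ ∸ 1
    i₃ = i₂ ∸ r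
    third : ¬ i < suc m → ¬ i₁ < 1 → Dec (i₂ < r) → rowLen c-rows i₂ ≡ lengths (suc (suc (locate (r ∷ᵛ 1 ∷ᵛ []ᵛ) i₂)))
    third _ _ (yes h) = trans (rowLen-replicate-< r (u + z) d-row h) (cong (λ k → lengths (suc (suc k))) (sym (locate-< r 1 []ᵛ h)))
    third ¬h₁ ¬h₂ (no ¬h) = trans (rowLen-replicate-≥ r (u + z) d-row ¬h)
      (trans (cong (rowLen d-row) i₃≡0) (cong (λ k → lengths (suc (suc k))) (sym (locate-≥ r 1 []ᵛ ¬h))))
      where
      -- `locate` sends every remaining index to the last group, so `i < length lam` has to pin it
      -- to 0, the single row d.
      i₃≡0 : i₃ ≡ 0
      i₃≡0 = n≤0⇒n≡0 (m≤n+o⇒m∸n≤o i₂ r (m≤n+o⇒m∸n≤o i₁ 1 (m≤n+o⇒m∸n≤o i (suc m)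
        (s≤s⁻¹ (≤-trans i<M (≤-reflexive (trans length-lam (bound m r))))))))
        where
        bound : ∀ m r → suc m + (1 + (r + (1 + 0))) ≡ suc (suc m + (1 + (r + 0)))
        bound = solve-∀
    second : ¬ i < suc m → Dec (i₁ < 1) → rowLen b-rows i₁ ≡ lengths (suc (locate (1 ∷ᵛ r ∷ᵛ 1 ∷ᵛ []ᵛ) i₁))
    second _ (yes h) = trans (rowLen-replicate-< 1 (u + z + y) c-rows h) (cong (λ k → lengths (suc k)) (sym (locate-< 1 r (1 ∷ᵛ []ᵛ) h)))
    second ¬h₁ (no ¬h) = trans (rowLen-replicate-≥ 1 (u + z + y) c-rows ¬h)
      (trans (third ¬h₁ ¬h (i₂ <? r)) (cong (λ k → lengths (suc k)) (sym (locate-≥ 1 r (1 ∷ᵛ []ᵛ) ¬h))))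
    first : Dec (i < suc m) → rowLen lam i ≡ lengths (locate multiplicities i)
    first (yes h) = trans (rowLen-replicate-< (suc m) (u + z + y + x) b-rows h) (cong lengths (sym (locate-< (suc m) 1 (r ∷ᵛ 1 ∷ᵛ []ᵛ) h)))
    first (no ¬h) = trans (rowLen-replicate-≥ (suc m) (u + z + y + x) b-rows ¬h)
      (trans (second ¬h (i₁ <? 1)) (cong lengths (sym (locate-≥ (suc m) 1 (r ∷ᵛ 1 ∷ᵛ []ᵛ) ¬h))))

  N≡ : u + z + y + x ≡ N
  N≡ = regroup u z y x
    where
    regroup : ∀ u z y x → u + z + y + x ≡ u + (z + (y + (x + 0)))
    regroup = solve-∀

  lengths≤N : ∀ k → lengths k ≤ N
  lengths≤N k = ≤-trans (below k) (≤-reflexive N≡)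
    where
    below : ∀ k → lengths k ≤ u + z + y + x
    below 0F = ≤-refl
    below 1F = m≤m+n (u + z + y) x
    below 2F = ≤-trans (m≤m+n (u + z) y) (m≤m+n (u + z + y) x)
    below 3F = ≤-trans (m≤m+n u z) (≤-trans (m≤m+n (u + z) y) (m≤m+n (u + z + y) x))

  data Position (c : ℕ) : Set where
    in-u : locate widths c ≡ 0F → c < u → Position c
    in-z : locate widths c ≡ 1F → u ≤ c → c < u + z → Position c
    in-y : locate widths c ≡ 2F → u + z ≤ c → c < u + z + y → Position c
    in-x : locate widths c ≡ 3F → u + z + y ≤ c → Position c

  position : ∀ c → Position c
  position c = first (c <? u)
    where
    ≥-shift : ∀ {p q c} → p ≤ c → q ≤ c ∸ p → p + q ≤ c
    ≥-shift {p} p≤c q≤ = ≤-trans (+-monoʳ-≤ p q≤) (≤-reflexive (m+[n∸m]≡n p≤c))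
    <-shift : ∀ {p q c} → p ≤ c → c ∸ p < q → c < p + q
    <-shift {p} p≤c <q = ≤-<-trans (≤-reflexive (sym (m+[n∸m]≡n p≤c))) (+-monoʳ-< p <q)
    third : ¬ c < u → ¬ c ∸ u < z → Dec (c ∸ u ∸ z < y) → Position c
    third c≥u c≥z h₃ = last h₃
      where
      u+z≤c : u + z ≤ c
      u+z≤c = ≥-shift (≮⇒≥ c≥u) (≮⇒≥ c≥z)
      to-third : ∀ {k} → locate (y ∷ᵛ x ∷ᵛ []ᵛ) (c ∸ u ∸ z) ≡ k → locate widths c ≡ suc (suc k)
      to-third eq = trans (locate-≥ u z (y ∷ᵛ x ∷ᵛ []ᵛ) c≥u) (cong suc (trans (locate-≥ z y (x ∷ᵛ []ᵛ) c≥z) (cong suc eq)))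
      last : Dec (c ∸ u ∸ z < y) → Position c
      last (yes h) = in-y (to-third (locate-< y x []ᵛ h)) u+z≤c (<-shift u+z≤c (subst (_< y) (∸-+-assoc c u z) h))
      last (no ¬h) = in-x (to-third (locate-≥ y x []ᵛ ¬h)) (≥-shift u+z≤c (subst (y ≤_) (∸-+-assoc c u z) (≮⇒≥ ¬h)))
    second : ¬ c < u → Dec (c ∸ u < z) → Position c
    second c≥u (yes h) = in-z (trans (locate-≥ u z (y ∷ᵛ x ∷ᵛ []ᵛ) c≥u) (cong suc (locate-< z y (x ∷ᵛ []ᵛ) h))) (≮⇒≥ c≥u) (<-shift (≮⇒≥ c≥u) h)
    second c≥u (no ¬h) = third c≥u ¬h (c ∸ u ∸ z <? y)
    first : Dec (c < u) → Position c
    first (yes h) = in-u (locate-< u z (y ∷ᵛ x ∷ᵛ []ᵛ) h) h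
    first (no ¬h) = second ¬h (c ∸ u <? z)

  meets-lengths : ∀ k c → c < N → meets k (locate widths c) ≡ does (c <? lengths k)
  meets-lengths k c c<N with position c
  ... | in-u eq c<u rewrite eq = below k
    where
    c<c : c < u + z
    c<c = <-≤-trans c<u (m≤m+n u z)
    c<b : c < u + z + y
    c<b = <-≤-trans c<c (m≤m+n (u + z) y)
    below : ∀ k → meets k 0F ≡ does (c <? lengths k)
    below 0F = sym (dec-true (c <? u + z + y + x) (subst (c <_) (sym N≡) c<N))
    below 1F = sym (dec-true (c <? u + z + y) c<b)
    below 2F = sym (dec-true (c <? u + z) c<c)
    below 3F = sym (dec-true (c <? u) c<u)
  ... | in-z eq u≤c c<c rewrite eq = below k
    where
    below : ∀ k → meets k 1F ≡ does (c <? lengths k)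
    below 0F = sym (dec-true (c <? u + z + y + x) (subst (c <_) (sym N≡) c<N))
    below 1F = sym (dec-true (c <? u + z + y) (<-≤-trans c<c (m≤m+n (u + z) y)))
    below 2F = sym (dec-true (c <? u + z) c<c)
    below 3F = sym (dec-false (c <? u) (≤⇒≯ u≤c))
  ... | in-y eq c≤c c<b rewrite eq = below k
    where
    below : ∀ k → meets k 2F ≡ does (c <? lengths k)
    below 0F = sym (dec-true (c <? u + z + y + x) (subst (c <_) (sym N≡) c<N))
    below 1F = sym (dec-true (c <? u + z + y) c<b)
    below 2F = sym (dec-false (c <? u + z) (≤⇒≯ c≤c))
    below 3F = sym (dec-false (c <? u) (≤⇒≯ (≤-trans (m≤m+n u z) c≤c)))
  ... | in-x eq b≤c rewrite eq = below k
    where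
    c≤c : u + z ≤ c
    c≤c = ≤-trans (m≤m+n (u + z) y) b≤c
    below : ∀ k → meets k 3F ≡ does (c <? lengths k)
    below 0F = sym (dec-true (c <? u + z + y + x) (subst (c <_) (sym N≡) c<N))
    below 1F = sym (dec-false (c <? u + z + y) (≤⇒≯ b≤c))
    below 2F = sym (dec-false (c <? u + z) (≤⇒≯ c≤c))
    below 3F = sym (dec-false (c <? u) (≤⇒≯ (≤-trans (m≤m+n u z) c≤c)))

  shape : ∀ i c → meets (ρ i) (κ c) ≡ does (toℕ c <? rowLen lam (toℕ i))
  shape i c = trans (meets-lengths (ρ i) (toℕ c) (Finₚ.toℕ<n c))
    (cong (λ l → does (toℕ c <? l)) (sym (rowLen-lam (toℕ i) (Finₚ.toℕ<n i))))

  latin : Latin lam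
  latin = FromOutline.latin lam N N≡
    (rowLen≤ lam λ i i<M → ≤-trans (≤-reflexive (rowLen-lam i i<M)) (lengths≤N (locate multiplicities i)))
    ρ κ meets shape X
    (λ k a → trans (X-rows k a) (sym (cong₂ (λ v n → ⟦ meets k a ⟧ * v * n) (count-κ a) (count-ρ k))))
    (λ k b → trans (X-columns k b) (sym (cong₂ (λ v n → ⟦ meets k b ⟧ * v * n) (count-κ b) (count-ρ k))))
    (λ a b → ≤-trans (X-capacity a b) (≤-reflexive (sym (cong₂ _*_ (count-κ a) (count-κ b)))))

-- Wideness enters through four subpartitions: the whole partition, and those obtained by removing
-- b, all copies of a, or both.
wide⇒latin : ∀ x y z u m r → 0 < u → Wide (part x y z u (suc m) 1 r) → Latin (part x y z u (suc m) 1 r)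
wide⇒latin x y z u m r 0<u wide = Tableau-of-plan.latin (Plan.isPlan chosen) (rows≤width x y z u (suc m) r 0<u (dominates ≤-refl ≤-refl) (dominates ≤-refl z≤n))
  where
  mult-replicate-mono : ∀ t v {n n′} xs xs′ → n ≤ n′ → mult t xs ≤ mult t xs′ → mult t (replicate n v ++ xs) ≤ mult t (replicate n′ v ++ xs′)
  mult-replicate-mono t v {zero} {n′} xs xs′ _ h = ≤-trans h (≤-trans (m≤n+m _ (mult t (replicate n′ v))) (≤-reflexive (sym (mult-++ t (replicate n′ v) xs′))))
  mult-replicate-mono t v {suc n} {suc n′} xs xs′ (s≤s n≤n′) h =
    ≤-trans (≤-reflexive (length-filter-∷ (t ≟_) v (replicate n v ++ xs)))
      (≤-trans (+-monoʳ-≤ ⟦ does (t ≟ v) ⟧ (mult-replicate-mono t v xs xs′ n≤n′ h))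
        (≤-reflexive (sym (length-filter-∷ (t ≟_) v (replicate n′ v ++ xs′)))))
  dominates : ∀ {m′ p′} → m′ ≤ suc m → p′ ≤ 1 → Dominates (part x y z u m′ p′ r) (conj (part x y z u m′ p′ r))
  dominates {m′} {p′} m′≤ p′≤ = wide (part x y z u m′ p′ r) (part-partition x y z u m′ p′ r 0<u , λ t →
    mult-replicate-mono t (u + z + y + x) (replicate p′ (u + z + y) ++ c-rows) (replicate 1 (u + z + y) ++ c-rows) m′≤
      (mult-replicate-mono t (u + z + y) c-rows c-rows p′≤ ≤-refl))
    where
    c-rows : List ℕ
    c-rows = replicate r (u + z) ++ u ∷ []
  ineqs₀ : WideIneqs x y z u r 0
  ineqs₀ = wideIneqs x y z u 0 r 0<u (dominates z≤n ≤-refl) (dominates z≤n z≤n)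
  -- Dominance of c^r d at d, divided by d: this subpartition has at most c rows.
  r+1≤c : r + 1 ≤ z + u
  r+1≤c = *-cancelʳ-≤ (r + 1) (z + u) u {{>-nonZero 0<u}} (subst₂ _≤_ (cong (_* u) (+-comm 1 r)) (sym (*-distribʳ-+ u z u)) (WideIneqs.sans-b-at-d ineqs₀))
  chosen : Plan x y z u r (suc m)
  chosen = plan 0<u r+1≤c ineqs₀ (wideIneqs x y z u (suc m) r 0<u (dominates ≤-refl ≤-refl) (dominates ≤-refl z≤n))

-- Recognising the shape

-- The inequalities are weak on purpose: equal neighbours become blocks of width 0, which is how
-- three part sizes are covered.
wide⇒latin-parts : ∀ m r {a b c d} → 0 < d → d ≤ c → c ≤ b → b ≤ a →
  let lam = replicate (suc m) a ++ b ∷ replicate r c ++ d ∷ [] in Wide lam → Latin lam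
wide⇒latin-parts m r {d = d} 0<d d≤c c≤b b≤a with m≤n⇒∃[o]m+o≡n d≤c
... | z , refl with m≤n⇒∃[o]m+o≡n c≤b
... | y , refl with m≤n⇒∃[o]m+o≡n b≤a
... | x , refl = wide⇒latin x y z d m r 0<d

record LeadingRun (a : ℕ) (ds lam : List ℕ) : Set where
  constructor run
  field
    {k}   : ℕ
    {rest} : List ℕ
    lam≡    : lam ≡ replicate (suc k) a ++ rest
    rest<   : All (_< a) rest
    sorted  : Linked _≥_ rest
    parts   : distinctParts rest ≡ ds

-- In a sorted list the copies of the first part form an initial segment, and below it all parts are
-- strictly smaller. The filter inside `deduplicate` therefore removes at most the head of the
-- remaining distinct parts.
leadingRun : ∀ x xs → Linked _≥_ (x ∷ xs) → ∃ λ ds → distinctParts (x ∷ xs) ≡ x ∷ ds × LeadingRun x ds (x ∷ xs)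
leadingRun x []       [-]        = [] , refl , run {k = 0} refl []ᵃ []ˡ refl
leadingRun x (y ∷ ys) (y≤x ∷ˡ l) with x ≟ y | leadingRun y ys l
... | yes refl | ds , eq , run lam≡ rest< sorted parts =
  ds , cong (x ∷_) (trans (cong (filter (¬? ∘ (x ≟_))) eq) (trans (Listₚ.filter-reject (¬? ∘ (x ≟_)) λ x≢x → x≢x refl)
    (Listₚ.filter-all (¬? ∘ (x ≟_)) (All.map (λ h → <⇒≢ h ∘ sym) (subst (All (_< x)) parts (Allₚ.deduplicate⁺ _≟_ rest<)))))) ,
  run (cong (x ∷_) lam≡) rest< sorted parts
... | no x≢y | _ =
  distinctParts (y ∷ ys) , cong (x ∷_) (Listₚ.filter-all (¬? ∘ (x ≟_)) (All.map (λ h → <⇒≢ h ∘ sym) (Allₚ.deduplicate⁺ _≟_ below))) ,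
  run {k = 0} refl below l refl
  where
  below : All (_< x) (y ∷ ys)
  below = All.map (λ h → ≤-<-trans h (≤∧≢⇒< y≤x (x≢y ∘ sym))) (largest-bound l)

leading : ∀ {lam a ds} → Linked _≥_ lam → distinctParts lam ≡ a ∷ ds → LeadingRun a ds lam
leading {x ∷ xs} l eq with leadingRun x xs l
... | ds , eq′ , r with trans (sym eq′) eq
... | refl = r

no-parts : ∀ {lam} → distinctParts lam ≡ [] → lam ≡ []
no-parts {[]} _ = refl

mult-skip : ∀ {t v} → t ≢ v → ∀ n xs → mult t (replicate n v ++ xs) ≡ mult t xs
mult-skip t≢v zero    xs = refl
mult-skip {t} t≢v (suc n) xs = trans (cong length (Listₚ.filter-reject (t ≟_) t≢v)) (mult-skip t≢v n xs)

mult-run : ∀ t n {xs} → All (_< t) xs → mult t (replicate n t ++ xs) ≡ n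
mult-run t zero    xs<t = cong length (Listₚ.filter-none (t ≟_) (All.map (λ h → <⇒≢ h ∘ sym) xs<t))
mult-run t (suc n) xs<t = trans (cong length (Listₚ.filter-accept (t ≟_) refl)) (cong suc (mult-run t n xs<t))

replicate-snoc : ∀ n (v : ℕ) → replicate (suc n) v ++ [] ≡ replicate n v ++ v ∷ []
replicate-snoc zero    v = refl
replicate-snoc (suc n) v = cong (v ∷_) (replicate-snoc n v)

head-of-run : ∀ {P : ℕ → Set} {v k xs} → All P (replicate (suc k) v ++ xs) → P v
head-of-run (pv ∷ᵃ _) = pv

theorem4 : (lam : List ℕ) → IsPartition lam → Wide lam →
    ((∃[ a ] ∃[ b ] ∃[ c ] (distinctParts lam ≡ a ∷ b ∷ c ∷ [])
    × (mult b lam ≡ 1 ⊎ mult c lam ≡ 1))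
    ⊎ (∃[ a ] ∃[ b ] ∃[ c ] ∃[ d ] (distinctParts lam ≡ a ∷ b ∷ c ∷ d ∷ [])
    × (mult b lam ≡ 1 × mult d lam ≡ 1))) →
    Latin lam
theorem4 lam (sorted , positive) wide (inj₁ (a , b , c , dp , mult≡1)) with leading sorted dp
... | run {m} refl rest<a sorted₁ dp₁ with leading sorted₁ dp₁
... | run {p} refl rest<b sorted₂ dp₂ with leading sorted₂ dp₂
... | run {q} refl rest<c _ dp₃ with no-parts dp₃
... | refl = conclude mult≡1
  where
  b<a : b < a
  b<a = head-of-run {k = p} rest<a
  c<b : c < b
  c<b = head-of-run {k = q} rest<b
  0<c : 0 < c
  0<c = head-of-run {k = q} (Allₚ.++⁻ʳ (replicate (suc p) b) (Allₚ.++⁻ʳ (replicate (suc m) a) positive))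
  conclude : mult b lam ≡ 1 ⊎ mult c lam ≡ 1 → Latin lam
  -- One copy of `c` is split off to serve as the last part; the other `q` copies form the third
  -- group.
  conclude (inj₁ b-once) = subst Latin (sym lam≡) (wide⇒latin-parts m q 0<c ≤-refl (<⇒≤ c<b) (<⇒≤ b<a) (subst Wide lam≡ wide))
    where
    p≡0 : suc p ≡ 1
    p≡0 = trans (sym (trans (mult-skip (<⇒≢ b<a) (suc m) _) (mult-run b (suc p) rest<b))) b-once
    lam≡ : lam ≡ replicate (suc m) a ++ b ∷ replicate q c ++ c ∷ []
    lam≡ = cong (replicate (suc m) a ++_) (cong₂ (λ n xs → replicate n b ++ xs) p≡0 (replicate-snoc q c))
  -- One copy of `b` serves as the single second part, the other `p` copies form the third group,
  -- and `c` is the last part.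
  conclude (inj₂ c-once) = subst Latin (sym lam≡) (wide⇒latin-parts m p 0<c (<⇒≤ c<b) ≤-refl (<⇒≤ b<a) (subst Wide lam≡ wide))
    where
    q≡0 : suc q ≡ 1
    q≡0 = trans (sym (trans (mult-skip (<⇒≢ (<-trans c<b b<a)) (suc m) _) (trans (mult-skip (<⇒≢ c<b) (suc p) _) (mult-run c (suc q) rest<c)))) c-once
    lam≡ : lam ≡ replicate (suc m) a ++ b ∷ replicate p b ++ c ∷ []
    lam≡ = cong (λ n → replicate (suc m) a ++ replicate (suc p) b ++ replicate n c ++ []) q≡0
theorem4 lam (sorted , positive) wide (inj₂ (a , b , c , d , dp , b-once , d-once)) with leading sorted dp
... | run {m} refl rest<a sorted₁ dp₁ with leading sorted₁ dp₁
... | run {p} refl rest<b sorted₂ dp₂ with leading sorted₂ dp₂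
... | run {q} refl rest<c sorted₃ dp₃ with leading sorted₃ dp₃
... | run {s} refl rest<d _ dp₄ with no-parts dp₄
... | refl = subst Latin (sym lam≡) (wide⇒latin-parts m (suc q) 0<d (<⇒≤ d<c) (<⇒≤ c<b) (<⇒≤ b<a) (subst Wide lam≡ wide))
  where
  b<a : b < a
  b<a = head-of-run {k = p} rest<a
  c<b : c < b
  c<b = head-of-run {k = q} rest<b
  d<c : d < c
  d<c = head-of-run {k = s} rest<c
  0<d : 0 < d
  0<d = head-of-run {k = s} (Allₚ.++⁻ʳ (replicate (suc q) c) (Allₚ.++⁻ʳ (replicate (suc p) b) (Allₚ.++⁻ʳ (replicate (suc m) a) positive)))
  p≡0 : suc p ≡ 1
  p≡0 = trans (sym (trans (mult-skip (<⇒≢ b<a) (suc m) _) (mult-run b (suc p) rest<b))) b-once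
  s≡0 : suc s ≡ 1
  s≡0 = trans (sym (trans (mult-skip (<⇒≢ (<-trans d<c (<-trans c<b b<a))) (suc m) _) (trans (mult-skip (<⇒≢ (<-trans d<c c<b)) (suc p) _)
    (trans (mult-skip (<⇒≢ d<c) (suc q) _) (mult-run d (suc s) rest<d))))) d-once
  lam≡ : lam ≡ replicate (suc m) a ++ b ∷ replicate (suc q) c ++ d ∷ []
  lam≡ = cong₂ (λ n n′ → replicate (suc m) a ++ replicate n b ++ replicate (suc q) c ++ replicate n′ d ++ []) p≡0 s≡0
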